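{- Let $\mathcal{B}^\bullet_n(P)$ denote the set of t-shelves of size $n\ge1$ having no node with two children whose left child has a smaller label than its right child (i.e. t-shelves avoiding the pattern $P$ given by the size-3 t-shelf with root $1$, left child $2$ and right child $3$). Let $g_{n,k}$ be the number of t-shelves in $\mathcal{B}^\bullet_n(P)$ having exactly $k$ left children. Then $$\sum_{n\ge1}\sum_{k\ge0} g_{n,k}\frac{z^ny^k}{n!} = \frac{ -2}{1+y-\sqrt{y^2+1}\,\coth\left(\frac{z\sqrt{y^2+1}}{2}\right)}.$$
   Context: A treeshelf (t-shelf) of size $n\ge 1$ is a rooted binary tree with $n$ nodes labeled bijectively by $\{1,\dots,n\}$ so that labels strictly increase along every path starting at the root, in which every node has at most one left child and at most one right child, and every child (including a child with no sibling) is designated either as the left child or the right child of its parent. A left child is a node that is the left child of its parent; the number of left children of a t-shelf is the number of such nodes. -}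

module Defs where

open import Data.Bool using (Bool; true; false; _∧_; _∨_; not; T)
open import Data.Nat as N using (ℕ; zero; suc; _∸_; _!; _≡ᵇ_; _<ᵇ_)
open import Data.Nat.Properties using (_!≢0)
open import Data.Integer using (+_)
open import Data.List using (List; []; _∷_; _++_; length)
open import Data.Product using (Σ)
open import Data.Rational using (ℚ; 0ℚ; 1ℚ; _+_; _*_; -_; 1/_; _/_; ≢-nonZero)
open import Data.Rational.Properties using (_≟_)
open import Relation.Nullary using (yes; no)

data BTree : Set where
  nil  : BTree
  node : BTree → ℕ → BTree → BTree

labels : BTree → List ℕ
labels nil          = []
labels (node l a r) = a ∷ labels l ++ labels r

size : BTree → ℕ
size t = length (labels t)

countOcc : ℕ → List ℕ → ℕ
countOcc i []       = 0
countOcc i (x ∷ xs) with i ≡ᵇ x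
... | true  = suc (countOcc i xs)
... | false = countOcc i xs

occursOnce : ℕ → List ℕ → ℕ → Bool
occursOnce n xs zero    = true
occursOnce n xs (suc i) = (countOcc (suc i) xs ≡ᵇ 1) ∧ occursOnce n xs i

labelledBy : ℕ → BTree → Bool
labelledBy n t = (size t ≡ᵇ n) ∧ occursOnce n (labels t) n

allB : (ℕ → Bool) → List ℕ → Bool
allB p []       = true
allB p (x ∷ xs) = p x ∧ allB p xs

increasing : BTree → Bool
increasing nil          = true
increasing (node l a r) =
  allB (λ b → a <ᵇ b) (labels l ++ labels r) ∧ increasing l ∧ increasing r

isTShelf : ℕ → BTree → Bool
isTShelf n t = labelledBy n t ∧ increasing t

badNode : BTree → BTree → Bool
badNode (node _ b _) (node _ c _) = b <ᵇ c
badNode _            _            = false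

avoidsP : BTree → Bool
avoidsP nil          = true
avoidsP (node l a r) = not (badNode l r) ∧ avoidsP l ∧ avoidsP r

leftChildren : BTree → ℕ
leftChildren nil                       = 0
leftChildren (node nil _ r)            = leftChildren r
leftChildren (node l@(node _ _ _) _ r) = suc (leftChildren l N.+ leftChildren r)

-- The set of t-shelves in B•_n(P) with exactly k left children.
-- (The predicate is a `T` of a Boolean, hence proof-irrelevant, so
-- the cardinality of this Σ-type is the number of such trees.)
G : ℕ → ℕ → Set
G n k = Σ BTree (λ t → T (isTShelf n t ∧ avoidsP t ∧ (leftChildren t ≡ᵇ k)))

-- s n k = coefficient of z^n y^k
Ser : Set
Ser = ℕ → ℕ → ℚ

sumTo : ℕ → (ℕ → ℚ) → ℚ
sumTo zero    f = f 0
sumTo (suc n) f = sumTo n f + f (suc n)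

fromℕℚ : ℕ → ℚ
fromℕℚ n = + n / 1

-- total reciprocal (1/0 := 0; only ever used on nonzero arguments)
recip : ℚ → ℚ
recip q with q ≟ 0ℚ
... | yes _  = 0ℚ
... | no q≢0 = 1/_ q {{≢-nonZero q≢0}}

constS : ℚ → Ser
constS c zero zero = c
constS c _    _    = 0ℚ

zS : Ser
zS 1 0 = 1ℚ
zS _ _ = 0ℚ

yS : Ser
yS 0 1 = 1ℚ
yS _ _ = 0ℚ

infixl 6 _+ₛ_ _-ₛ_
infixl 7 _*ₛ_

_+ₛ_ : Ser → Ser → Ser
(f +ₛ g) n k = f n k + g n k

negS : Ser → Ser
negS f n k = - f n k

_-ₛ_ : Ser → Ser → Ser
f -ₛ g = f +ₛ negS g

_*ₛ_ : Ser → Ser → Ser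
(f *ₛ g) n k = sumTo n (λ i → sumTo k (λ j → f i j * g (n ∸ i) (k ∸ j)))

scaleS : ℚ → Ser → Ser
scaleS c f n k = c * f n k

powS : Ser → ℕ → Ser
powS f zero    = constS 1ℚ
powS f (suc m) = f *ₛ powS f m

-- Composition  a(w) = Σ_m a_m w^m  of a univariate series a with a
-- bivariate series w having zero constant term; the coefficient of
-- z^n y^k only receives contributions from m ≤ n + k.
compose : (ℕ → ℚ) → Ser → Ser
compose a w n k = sumTo (n N.+ k) (λ m → a m * powS w m n k)

-- Multiplicative inverse of a series f with nonzero constant term c:
-- f = c (1 - u) with u = 1 - f/c having zero constant term, and
-- f⁻¹ = c⁻¹ Σ_m u^m.
invS : Ser → Ser
invS f = scaleS (recip c) (compose (λ _ → 1ℚ) (constS 1ℚ -ₛ scaleS (recip c) f))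
  where c = f 0 0

invFact : ℕ → ℚ
invFact m = (+ 1 / (m !)) {{m !≢0}}

halfFalling : ℕ → ℚ
halfFalling zero    = 1ℚ
halfFalling (suc m) = halfFalling m * ((+ 1 / 2) + - fromℕℚ m)

halfChoose : ℕ → ℚ
halfChoose m = halfFalling m * invFact m

sqrt1pCoeff : ℕ → ℚ
sqrt1pCoeff = halfChoose

isEven : ℕ → Bool
isEven zero          = true
isEven (suc zero)    = false
isEven (suc (suc j)) = isEven j

coshCoeff : ℕ → ℚ
coshCoeff j with isEven j
... | true  = invFact j
... | false = 0ℚ

sinhCoeff : ℕ → ℚ
sinhCoeff j with isEven j
... | true  = 0ℚ
... | false = invFact j

sqrtY : Ser
sqrtY = compose sqrt1pCoeff (yS *ₛ yS)

wS : Ser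
wS = scaleS (+ 1 / 2) (zS *ₛ sqrtY)

coshW sinhW : Ser
coshW = compose coshCoeff wS
sinhW = compose sinhCoeff wS

-- Writing coth = cosh / sinh and multiplying numerator and denominator
-- by sinh w (which turns the Laurent series into power series):
--   -2 / (1 + y - s·cosh w / sinh w)
--     = (-2 · sinh w) · ((1 + y)·sinh w - s·cosh w)⁻¹,
-- where the second factor has constant term -1, hence is invertible.
rhs : Ser
rhs = scaleS (- (+ 2 / 1)) sinhW
      *ₛ invS ((constS 1ℚ +ₛ yS) *ₛ sinhW -ₛ sqrtY *ₛ coshW)

{-# OPTIONS --safe #-}

{-
For a t-shelf t avoiding P, the largest label sits at a leaf, and removing it leaves a smaller
avoiding t-shelf. Conversely a new largest leaf may be attached to a childless node (on either side)
or, on the left, to a node having only a right child. Let F be the right-hand side, X = ∂F/∂z and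
U = 1 + yF. The closed form yields the Riccati-type relations ∂X = X (y + U) and ∂U = y X together
with X(0) = U(0) = 1. Give a childless node the weight X, a node with only a right child the weight U,
and every left child a factor y: by the Leibniz rule ∂ of the weight of t is the sum of the weights
of all trees grown from t by one leaf. Hence the n-th derivative of F is the total weight of the
avoiding t-shelves of size n, and at z = 0 this is the sum of their y^(number of left children).
-}

module Submission where

open import Defs
open import Data.Nat using (ℕ; _≥_; _!)
open import Data.Nat.Properties using (_!≢0)
open import Data.Fin using (Fin)
open import Data.Integer using (+_)
open import Data.Product using (_×_)
open import Data.Rational using (ℚ; 0ℚ; _/_)
open import Function.Bundles using (_↔_)
open import Relation.Binary.PropositionalEquality using (_≡_)

open import Algebra.Bundles using (CommutativeRing)
import Algebra.Properties.CommutativeMonoid.Mult as CommutativeMonoidMult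
import Algebra.Properties.CommutativeSemigroup as CommutativeSemigroupProperties
import Algebra.Properties.Ring as RingProperties
import Algebra.Properties.Semiring.Mult as SemiringMult
import Algebra.Solver.Ring as RingSolver
open import Algebra.Solver.Ring.AlmostCommutativeRing
  using (fromCommutativeRing; _-Raw-AlmostCommutative⟶_)
open import Data.Bool using (Bool; true; false; not; T; _∧_)
import Data.Bool.Properties as Bool
open import Data.Fin using (zero; suc)
open import Data.Fin.Permutation using (↔⇒≡)
import Data.Integer as ℤ
import Data.Integer.Properties as ℤ
open import Data.List using (List; []; _∷_; _++_; length; map; filter; lookup; concatMap)
import Data.List.Properties as List
open import Data.List.Membership.Propositional using (_∈_; _∉_; find; lose)
open import Data.List.Membership.Propositional.Properties
  using (∈-map⁺; ∈-map⁻; ∈-++⁺ˡ; ∈-++⁺ʳ; ∈-++⁻; ∈-concatMap⁺; ∈-concatMap⁻; ∈-filter⁺; ∈-filter⁻; ∈-∃++; ∈-lookup)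
open import Data.List.Relation.Binary.Disjoint.Propositional using (Disjoint)
import Data.List.Relation.Binary.Permutation.Propositional as ↭
open ↭ using (_↭_; ↭-sym)
open import Data.List.Relation.Binary.Permutation.Propositional.Properties
  using (All-resp-↭; ∈-resp-↭; ↭-length; ++⁺ˡ; ++⁺ʳ; shift)
open import Data.List.Relation.Unary.All as All using (All; []; _∷_)
import Data.List.Relation.Unary.All.Properties as All
open import Data.List.Relation.Unary.AllPairs using ([]; _∷_)
open import Data.List.Relation.Unary.Any using (here; there; index)
open import Data.List.Relation.Unary.Any.Properties using (lookup-index)
open import Data.List.Relation.Unary.Unique.Propositional using (Unique)
import Data.List.Relation.Unary.Unique.Propositional.Properties as Unique
open import Data.Maybe using (Maybe; just; nothing)
open import Data.Nat as ℕ using (zero; suc; z≤n; s≤s; _∸_)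
import Data.Nat.Properties as ℕ
open import Data.Product using (∃; _,_; proj₁; proj₂)
import Data.Rational as ℚ
import Data.Rational.Properties as ℚ
import Data.Rational.Solver as ℚ
import Data.Rational.Unnormalised as ℚᵘ
import Data.Rational.Unnormalised.Properties as ℚᵘ
open import Data.Sum using (inj₁; inj₂)
open import Data.Unit using (⊤; tt)
open import Function using (_∘_; Equivalence; Injective)
open import Function.Bundles using (mk↔ₛ′; _⇔_; mk⇔)
open import Function.Construct.Composition using (_↔-∘_)
open import Level using (0ℓ)
import Relation.Binary.PropositionalEquality as ≡
import Relation.Binary.Reasoning.Setoid as SetoidReasoning
open import Relation.Nullary using (¬_; yes; no; contradiction)

-- Formal power series over a commutative ring

-- Composition is given only coefficientwise, by truncated sums. The argument avoids
-- multiplicativity of composition and a general chain rule: it uses the relation a(w) = a₀ + w ·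
-- (tail a)(w). The identities behind the closed form then follow from uniqueness of solutions:
-- cosh² = 1 + sinh² because both sides have the same z-derivative and the same value at z = 0, and
-- the square of the root of 1 + y² from a linear recurrence for its coefficients. The Riccati
-- computation takes place in an abstract differential ring, with coth cleared, so that the only
-- inverse is that of (1 + y) sinh - s cosh. The weights are forced by what a node can still accept.
-- A node with a left child accepts nothing and has weight 1. A node with only a right child accepts
-- one left leaf, so its weight must be an antiderivative of y X, namely U. A childless node becomes
-- either a saturated node with a left leaf (y X) or a node of weight U with a right leaf (U X),
-- which is ∂X = X (y + U). Cardinalities enter the theorem as bijections with `Fin m`, hence the
-- shelves are also listed without repetition.

tail : ∀ {a} {A : Set a} → (ℕ → A) → ℕ → A
tail f n = f (suc n)

module PowerSeries {c ℓ} (R : CommutativeRing c ℓ) where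
  open CommutativeRing R
  open CommutativeSemigroupProperties +-commutativeSemigroup using (interchange; x∙yz≈y∙xz)
  open CommutativeSemigroupProperties *-commutativeSemigroup using () renaming (x∙yz≈y∙xz to x*yz≈y*xz)
  open CommutativeMonoidMult +-commutativeMonoid using (×-distrib-+)
  open SemiringMult semiring using (×-congʳ; ×-assoc-*; ×-comm-*; ×-assocˡ) renaming (_×_ to _·_)
  open SetoidReasoning setoid

  infix 4 _≋_
  infixl 7 _⊛_

  _≋_ : (f g : ℕ → Carrier) → Set ℓ
  f ≋ g = ∀ n → f n ≈ g n

  -- The Cauchy product, by recursion along f = f₀ + z · tail f; the ring laws become inductions on
  -- the index without any finite sums.
  _⊛_ : (f g : ℕ → Carrier) → ℕ → Carrier
  (f ⊛ g) zero    = f 0 * g 0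
  (f ⊛ g) (suc n) = f 0 * g (suc n) + (tail f ⊛ g) n

  const : Carrier → ℕ → Carrier
  const a zero    = a
  const a (suc n) = 0#

  ⊛-cong : ∀ {f f′ g g′} → f ≋ f′ → g ≋ g′ → f ⊛ g ≋ f′ ⊛ g′
  ⊛-cong p q zero    = *-cong (p 0) (q 0)
  ⊛-cong p q (suc n) = +-cong (*-cong (p 0) (q (suc n))) (⊛-cong (p ∘ suc) q n)

  ⊛-distribʳ : ∀ h f g → (λ n → f n + g n) ⊛ h ≋ λ n → (f ⊛ h) n + (g ⊛ h) n
  ⊛-distribʳ h f g zero    = distribʳ (h 0) (f 0) (g 0)
  ⊛-distribʳ h f g (suc n) = trans
    (+-cong (distribʳ (h (suc n)) (f 0) (g 0)) (⊛-distribʳ h (tail f) (tail g) n))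
    (interchange _ _ _ _)

  ⊛-zeroˡ : ∀ {f} g → f ≋ (λ _ → 0#) → f ⊛ g ≋ λ _ → 0#
  ⊛-zeroˡ g f≋0 zero    = trans (*-congʳ (f≋0 0)) (zeroˡ (g 0))
  ⊛-zeroˡ g f≋0 (suc n) = trans
    (+-cong (trans (*-congʳ (f≋0 0)) (zeroˡ _)) (⊛-zeroˡ g (f≋0 ∘ suc) n)) (+-identityˡ 0#)

  const-⊛ : ∀ a g → const a ⊛ g ≋ λ n → a * g n
  const-⊛ a g zero    = refl
  const-⊛ a g (suc n) = trans (+-congˡ (⊛-zeroˡ g (λ _ → refl) n)) (+-identityʳ _)

  X : ℕ → Carrier
  X zero    = 0#
  X (suc n) = const 1# n

  X-⊛-zero : ∀ {f} g → f ≋ X → (f ⊛ g) 0 ≈ 0#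
  X-⊛-zero g f≋X = trans (*-congʳ (f≋X 0)) (zeroˡ _)

  X-⊛-suc : ∀ {f} g → f ≋ X → ∀ n → (f ⊛ g) (suc n) ≈ g n
  X-⊛-suc {f} g f≋X n = begin
    f 0 * g (suc n) + (tail f ⊛ g) n ≈⟨ +-cong (trans (*-congʳ (f≋X 0)) (zeroˡ _)) (⊛-cong (f≋X ∘ suc) (λ _ → refl) n) ⟩
    0# + (const 1# ⊛ g) n            ≈⟨ +-identityˡ _ ⟩
    (const 1# ⊛ g) n                 ≈⟨ const-⊛ 1# g n ⟩
    1# * g n                         ≈⟨ *-identityˡ _ ⟩
    g n                              ∎

  ⊛-suc-last : ∀ f g n → (f ⊛ g) (suc n) ≈ (f ⊛ tail g) n + f (suc n) * g 0
  ⊛-suc-last f g zero    = refl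
  ⊛-suc-last f g (suc n) = trans (+-congˡ (⊛-suc-last (tail f) g n)) (sym (+-assoc _ _ _))

  ⊛-comm : ∀ f g → f ⊛ g ≋ g ⊛ f
  ⊛-comm f g zero    = *-comm (f 0) (g 0)
  ⊛-comm f g (suc n) = begin
    f 0 * g (suc n) + (tail f ⊛ g) n ≈⟨ +-cong (*-comm _ _) (⊛-comm (tail f) g n) ⟩
    g (suc n) * f 0 + (g ⊛ tail f) n ≈⟨ +-comm _ _ ⟩
    (g ⊛ tail f) n + g (suc n) * f 0 ≈⟨ ⊛-suc-last g f n ⟨
    (g ⊛ f) (suc n)                  ∎

  ⊛-scaleˡ : ∀ a f g → (λ n → a * f n) ⊛ g ≋ λ n → a * (f ⊛ g) n
  ⊛-scaleˡ a f g zero    = *-assoc a (f 0) (g 0)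
  ⊛-scaleˡ a f g (suc n) = trans
    (+-cong (*-assoc a (f 0) _) (⊛-scaleˡ a (tail f) g n)) (sym (distribˡ a _ _))

  ⊛-assoc : ∀ f g h → (f ⊛ g) ⊛ h ≋ f ⊛ (g ⊛ h)
  ⊛-assoc f g h zero    = *-assoc (f 0) (g 0) (h 0)
  ⊛-assoc f g h (suc n) = begin
    f 0 * g 0 * h (suc n) + (tail (f ⊛ g) ⊛ h) n
      ≈⟨ +-cong (*-assoc _ _ _) (⊛-distribʳ h (λ i → f 0 * g (suc i)) (tail f ⊛ g) n) ⟩
    f 0 * (g 0 * h (suc n)) + (((λ i → f 0 * tail g i) ⊛ h) n + ((tail f ⊛ g) ⊛ h) n)
      ≈⟨ +-congˡ (+-cong (⊛-scaleˡ (f 0) (tail g) h n) (⊛-assoc (tail f) g h n)) ⟩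
    f 0 * (g 0 * h (suc n)) + (f 0 * (tail g ⊛ h) n + (tail f ⊛ (g ⊛ h)) n)
      ≈⟨ +-assoc _ _ _ ⟨
    f 0 * (g 0 * h (suc n)) + f 0 * (tail g ⊛ h) n + (tail f ⊛ (g ⊛ h)) n
      ≈⟨ +-congʳ (distribˡ (f 0) _ _) ⟨
    f 0 * (g ⊛ h) (suc n) + (tail f ⊛ (g ⊛ h)) n ∎

  ⊛-identityˡ : ∀ g → const 1# ⊛ g ≋ g
  ⊛-identityˡ g n = trans (const-⊛ 1# g n) (*-identityˡ (g n))

  powerSeries : CommutativeRing c ℓ
  powerSeries = record
    { Carrier = ℕ → Carrier
    ; _≈_ = _≋_
    ; _+_ = λ f g n → f n + g n
    ; _*_ = _⊛_
    ; -_  = λ f n → - f n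
    ; 0#  = λ _ → 0#
    ; 1#  = const 1#
    ; isCommutativeRing = record
      { isRing = record
        { +-isAbelianGroup = record
          { isGroup = record
            { isMonoid = record
              { isSemigroup = record
                { isMagma = record
                  { isEquivalence = record
                    { refl  = λ n → refl
                    ; sym   = λ p n → sym (p n)
                    ; trans = λ p q n → trans (p n) (q n)
                    }
                  ; ∙-cong = λ p q n → +-cong (p n) (q n)
                  }
                ; assoc = λ f g h n → +-assoc (f n) (g n) (h n)
                }
              ; identity = (λ f n → +-identityˡ (f n)) , (λ f n → +-identityʳ (f n))
              }
            ; inverse = (λ f n → -‿inverseˡ (f n)) , (λ f n → -‿inverseʳ (f n))
            ; ⁻¹-cong = λ p n → -‿cong (p n)
            }
          ; comm = λ f g n → +-comm (f n) (g n)
          }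
        ; *-cong = ⊛-cong
        ; *-assoc = ⊛-assoc
        ; *-identity = ⊛-identityˡ , λ g n → trans (⊛-comm g (const 1#) n) (⊛-identityˡ g n)
        ; distrib = (λ h f g n → trans (⊛-comm h (λ i → f i + g i) n) (trans (⊛-distribʳ h f g n) (+-cong (⊛-comm f h n) (⊛-comm g h n))))
                  , ⊛-distribʳ
        }
      ; *-comm = ⊛-comm
      }
    }

  -- `θ` is the Euler operator z d/dz. It keeps degrees, so its Leibniz rule admits a direct
  -- induction, and `∂ f n` is `θ f (suc n)`.
  θ ∂ : (ℕ → Carrier) → ℕ → Carrier
  θ f n = n · f n
  ∂ f n = suc n · f (suc n)

  -- By definition `tail (θ f)` is `tail f` plus `θ (tail f)`; the additional `tail f` absorbs the
  -- one extra copy of the product contained in `suc n ·`.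
  θ-⊛ : ∀ f g → θ (f ⊛ g) ≋ λ n → (θ f ⊛ g) n + (f ⊛ θ g) n
  θ-⊛ f g zero    = sym (trans (+-cong (zeroˡ _) (zeroʳ _)) (+-identityˡ 0#))
  θ-⊛ f g (suc n) = begin
    suc n · (f 0 * g (suc n) + (tail f ⊛ g) n)
      ≈⟨ ×-distrib-+ _ _ (suc n) ⟩
    suc n · (f 0 * g (suc n)) + ((tail f ⊛ g) n + θ (tail f ⊛ g) n)
      ≈⟨ +-cong (sym (×-comm-* (suc n) _ _)) (+-congˡ (θ-⊛ (tail f) g n)) ⟩
    f 0 * θ g (suc n) + ((tail f ⊛ g) n + ((θ (tail f) ⊛ g) n + (tail f ⊛ θ g) n))
      ≈⟨ +-congˡ (+-assoc _ _ _) ⟨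
    f 0 * θ g (suc n) + ((tail f ⊛ g) n + (θ (tail f) ⊛ g) n + (tail f ⊛ θ g) n)
      ≈⟨ x∙yz≈y∙xz _ _ _ ⟩
    (tail f ⊛ g) n + (θ (tail f) ⊛ g) n + (f 0 * θ g (suc n) + (tail f ⊛ θ g) n)
      ≈⟨ +-congʳ (⊛-distribʳ g (tail f) (θ (tail f)) n) ⟨
    (tail (θ f) ⊛ g) n + (f ⊛ θ g) (suc n)
      ≈⟨ +-congʳ (trans (+-congʳ (zeroˡ _)) (+-identityˡ _)) ⟨
    (θ f ⊛ g) (suc n) + (f ⊛ θ g) (suc n) ∎

  -- The rule for `θ` shifted by one; both boundary terms vanish because `θ` annihilates the
  -- constant term.
  ∂-⊛ : ∀ f g → ∂ (f ⊛ g) ≋ λ n → (∂ f ⊛ g) n + (f ⊛ ∂ g) n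
  ∂-⊛ f g n = begin
    θ (f ⊛ g) (suc n)                        ≈⟨ θ-⊛ f g (suc n) ⟩
    (θ f ⊛ g) (suc n) + (f ⊛ θ g) (suc n)    ≈⟨ +-cong (trans (+-congʳ (zeroˡ _)) (+-identityˡ _)) (⊛-suc-last f (θ g) n) ⟩
    (∂ f ⊛ g) n + ((f ⊛ ∂ g) n + f (suc n) * 0#) ≈⟨ +-congˡ (trans (+-congˡ (zeroʳ _)) (+-identityʳ _)) ⟩
    (∂ f ⊛ g) n + (f ⊛ ∂ g) n                ∎

  ∂-cong : ∀ {f g} → f ≋ g → ∂ f ≋ ∂ g
  ∂-cong p n = ×-congʳ (suc n) (p (suc n))

  ∂-+ : ∀ f g → ∂ (λ n → f n + g n) ≋ λ n → ∂ f n + ∂ g n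
  ∂-+ f g n = ×-distrib-+ (f (suc n)) (g (suc n)) (suc n)

  ×-0# : ∀ n → n · 0# ≈ 0#
  ×-0# n = trans (×-congʳ n (sym (zeroˡ 0#))) (trans (sym (×-assoc-* n 0# 0#)) (zeroʳ _))

  ∂-const : ∀ a → ∂ (const a) ≋ λ _ → 0#
  ∂-const a n = ×-0# (suc n)

  ∂^ : ℕ → (ℕ → Carrier) → ℕ → Carrier
  ∂^ zero    f = f
  ∂^ (suc n) f = ∂ (∂^ n f)

  ∂^-∂ : ∀ n f → ∂^ n (∂ f) ≡ ∂^ (suc n) f
  ∂^-∂ zero    f = ≡.refl
  ∂^-∂ (suc n) f = ≡.cong ∂ (∂^-∂ n f)

  taylor : ∀ n f → ∂^ n f 0 ≈ (n !) · f n
  taylor zero    f = sym (+-identityʳ (f 0))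
  taylor (suc n) f = begin
    ∂^ (suc n) f 0              ≡⟨ ≡.cong (λ g → g 0) (∂^-∂ n f) ⟨
    ∂^ n (∂ f) 0                ≈⟨ taylor n (∂ f) ⟩
    (n !) · (suc n · f (suc n)) ≈⟨ ×-assocˡ (f (suc n)) (n !) (suc n) ⟩
    (n ! ℕ.* suc n) · f (suc n) ≡⟨ ≡.cong (_· f (suc n)) (ℕ.*-comm (n !) (suc n)) ⟩
    (suc n !) · f (suc n)       ∎

-- The differential equation, in any differential ring over ℚ

-- Collects what the calculus uses: a derivation vanishing on rational scalars. The homomorphism
-- from ℚ lets the ring solver treat ½ and -2 as coefficients.
record DifferentialℚAlgebra : Set₁ where
  field
    commutativeRing : CommutativeRing 0ℓ 0ℓ
  open CommutativeRing commutativeRing public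
  field
    scalars : ℚ.+-*-rawRing -Raw-AlmostCommutative⟶ fromCommutativeRing commutativeRing
  open _-Raw-AlmostCommutative⟶_ scalars public using (⟦_⟧; 0-homo; 1-homo)
  field
    D        : Carrier → Carrier
    D-cong   : ∀ {f g} → f ≈ g → D f ≈ D g
    D-+      : ∀ f g → D (f + g) ≈ D f + D g
    D-*      : ∀ f g → D (f * g) ≈ D f * g + f * D g
    D-scalar : ∀ q → D ⟦ q ⟧ ≈ 0#

module RiccatiEquation (𝔸 : DifferentialℚAlgebra) where
  open DifferentialℚAlgebra 𝔸 renaming (_-_ to _−_)
  open SetoidReasoning setoid

  scalar≟ : ∀ p q → Maybe (⟦ p ⟧ ≈ ⟦ q ⟧)
  scalar≟ p q with p ℚ.≟ q
  ... | yes ≡.refl = just refl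
  ... | no _       = nothing

  open RingSolver ℚ.+-*-rawRing (fromCommutativeRing commutativeRing) scalars scalar≟
    using (solve; _:=_; _:+_; _:*_; _:-_; :-_; con) public

  private
    -2ℚ = ℚ.- (ℤ.+ 2 / 1)

  D-1# : D 1# ≈ 0#
  D-1# = trans (D-cong (sym 1-homo)) (D-scalar ℚ.1ℚ)

  D-neg : ∀ f → D (- f) ≈ - D f
  D-neg f = begin
    D (- f)                         ≈⟨ solve 2 (λ a b → a := :- b :+ (b :+ a)) refl (D (- f)) (D f) ⟩
    - D f + (D f + D (- f))         ≈⟨ +-congˡ (D-+ f (- f)) ⟨
    - D f + D (f + - f)             ≈⟨ +-congˡ (D-cong (trans (-‿inverseʳ f) (sym 0-homo))) ⟩
    - D f + D ⟦ 0ℚ ⟧                ≈⟨ +-congˡ (D-scalar 0ℚ) ⟩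
    - D f + 0#                      ≈⟨ +-identityʳ _ ⟩
    - D f                           ∎

  D-constˡ : ∀ {c} f → D c ≈ 0# → D (c * f) ≈ c * D f
  D-constˡ {c} f Dc≈0 = begin
    D (c * f)           ≈⟨ D-* c f ⟩
    D c * f + c * D f   ≈⟨ +-congʳ (trans (*-congʳ Dc≈0) (zeroˡ f)) ⟩
    0# + c * D f        ≈⟨ +-identityˡ _ ⟩
    c * D f             ∎

  module _
    {s S C : Carrier}
    (DS : D S ≈ ⟦ ℚ.½ ⟧ * s * C)
    (DC : D C ≈ ⟦ ℚ.½ ⟧ * s * S)
    where

    -- Only the derivative of C² = 1 + S² can be had from the differential equations; the identity
    -- itself also needs an initial value, which an abstract ring does not offer.
    D-cosh² : D (C * C) ≈ D (1# + S * S)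
    D-cosh² = begin
      D (C * C)           ≈⟨ D-* C C ⟩
      D C * C + C * D C   ≈⟨ +-cong (*-congʳ DC) (*-congˡ DC) ⟩
      ⟦ ℚ.½ ⟧ * s * S * C + C * (⟦ ℚ.½ ⟧ * s * S)
        ≈⟨ solve 3 (λ s S C → con ℚ.½ :* s :* S :* C :+ C :* (con ℚ.½ :* s :* S)
                          := con ℚ.½ :* s :* C :* S :+ S :* (con ℚ.½ :* s :* C)) refl s S C ⟩
      ⟦ ℚ.½ ⟧ * s * C * S + S * (⟦ ℚ.½ ⟧ * s * C) ≈⟨ +-cong (*-congʳ DS) (*-congˡ DS) ⟨
      D S * S + S * D S   ≈⟨ D-* S S ⟨
      D (S * S)           ≈⟨ +-identityˡ _ ⟨
      0# + D (S * S)      ≈⟨ +-congʳ D-1# ⟨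
      D 1# + D (S * S)    ≈⟨ D-+ 1# (S * S) ⟨
      D (1# + S * S)      ∎

    module _
      {y V : Carrier}
      (Dy : D y ≈ 0#) (Ds : D s ≈ 0#)
      (s² : s * s ≈ 1# + y * y)
      (C² : C * C ≈ 1# + S * S)
      (VQ : V * ((1# + y) * S − s * C) ≈ 1#)
      where

      -- With S = sinh w, C = cosh w and w = zs/2, `Q` is the denominator 1 + y - s coth w
      -- multiplied by S, `V` its inverse and `F` the closed form.
      Q F : Carrier
      Q = (1# + y) * S − s * C
      F = ⟦ -2ℚ ⟧ * S * V

      D-1+y : D (1# + y) ≈ 0#
      D-1+y = trans (D-+ 1# y) (trans (+-cong D-1# Dy) (+-identityʳ 0#))

      DQ : D Q ≈ (1# + y) * (⟦ ℚ.½ ⟧ * s * C) − s * (⟦ ℚ.½ ⟧ * s * S)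
      DQ = begin
        D Q                                         ≈⟨ D-+ _ _ ⟩
        D ((1# + y) * S) + D (- (s * C))            ≈⟨ +-congˡ (D-neg _) ⟩
        D ((1# + y) * S) − D (s * C)                ≈⟨ +-cong (D-constˡ S D-1+y) (-‿cong (D-constˡ C Ds)) ⟩
        (1# + y) * D S − s * D C                    ≈⟨ +-cong (*-congˡ DS) (-‿cong (*-congˡ DC)) ⟩
        (1# + y) * (⟦ ℚ.½ ⟧ * s * C) − s * (⟦ ℚ.½ ⟧ * s * S) ∎

      -- Differentiate V Q = 1 and multiply by V.
      DV : D V ≈ - (V * V * D Q)
      DV = begin
        D V                          ≈⟨ *-identityʳ _ ⟨
        D V * 1#                     ≈⟨ *-congˡ VQ ⟨
        D V * (V * Q)                ≈⟨ solve 4 (λ DV V Q DQ → DV :* (V :* Q) := V :* (DV :* Q :+ V :* DQ) :- V :* V :* DQ) refl (D V) V Q (D Q) ⟩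
        V * (D V * Q + V * D Q) − V * V * D Q ≈⟨ +-congʳ (*-congˡ (trans (sym (D-* V Q)) (trans (D-cong VQ) D-1#))) ⟩
        V * 0# − V * V * D Q         ≈⟨ +-congʳ (zeroʳ V) ⟩
        0# − V * V * D Q             ≈⟨ +-identityˡ _ ⟩
        - (V * V * D Q)              ∎

      -- In the quotient rule for -2S/Q the terms with 1 + y cancel, leaving the numerator s² (C² -
      -- S²) = s².
      DF : D F ≈ s * s * (V * V)
      DF = begin
        D F                                           ≈⟨ D-* _ V ⟩
        D (⟦ -2ℚ ⟧ * S) * V + ⟦ -2ℚ ⟧ * S * D V       ≈⟨ +-cong (*-congʳ (D-constˡ S (D-scalar -2ℚ))) (*-congˡ DV) ⟩
        ⟦ -2ℚ ⟧ * D S * V + ⟦ -2ℚ ⟧ * S * - (V * V * D Q)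
          -- The first summand is multiplied by V Q = 1 to give both summands the factor V².
          ≈⟨ +-cong (sym (trans (*-congˡ VQ) (*-identityʳ _))) refl ⟩
        ⟦ -2ℚ ⟧ * D S * V * (V * Q) + ⟦ -2ℚ ⟧ * S * - (V * V * D Q)
          ≈⟨ +-cong (*-congʳ (*-congʳ (*-congˡ DS))) (*-congˡ (-‿cong (*-congˡ DQ))) ⟩
        ⟦ -2ℚ ⟧ * (⟦ ℚ.½ ⟧ * s * C) * V * (V * Q)
          + ⟦ -2ℚ ⟧ * S * - (V * V * ((1# + y) * (⟦ ℚ.½ ⟧ * s * C) − s * (⟦ ℚ.½ ⟧ * s * S)))
          ≈⟨ solve 6 (λ s S C V o y →
               con -2ℚ :* (con ℚ.½ :* s :* C) :* V :* (V :* ((o :+ y) :* S :- s :* C))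
               :+ con -2ℚ :* S :* :- (V :* V :* ((o :+ y) :* (con ℚ.½ :* s :* C) :- s :* (con ℚ.½ :* s :* S)))
               := s :* s :* (V :* V) :* (C :* C :- S :* S)) refl s S C V 1# y ⟩
        s * s * (V * V) * (C * C − S * S)             ≈⟨ *-congˡ (+-congʳ C²) ⟩
        s * s * (V * V) * (1# + S * S − S * S)        ≈⟨ *-congˡ (solve 2 (λ o S → o :+ S :* S :- S :* S := o) refl 1# S) ⟩
        s * s * (V * V) * 1#                          ≈⟨ *-identityʳ _ ⟩
        s * s * (V * V)                               ∎

      -- As D F is the constant s² times V², its logarithmic derivative is -2 V · D Q = V (s² S - (1
      -- + y) s C). Here s² = 1 + y² gives (1 + y²) S - (1 + y) s C = (1 + y) Q - 2 y S, and V turns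
      -- this into 1 + y + y F.
      DDF : D (D F) ≈ D F * (y + (1# + y * F))
      DDF = begin
        D (D F)                                       ≈⟨ D-cong DF ⟩
        D (s * s * (V * V))                           ≈⟨ D-constˡ (V * V) (trans (D-constˡ s Ds) (trans (*-congˡ Ds) (zeroʳ s))) ⟩
        s * s * D (V * V)                             ≈⟨ *-congˡ (D-* V V) ⟩
        s * s * (D V * V + V * D V)                   ≈⟨ *-congˡ (+-cong (*-congʳ DV) (*-congˡ DV)) ⟩
        s * s * (- (V * V * D Q) * V + V * - (V * V * D Q))
          ≈⟨ solve 3 (λ s V DQ → s :* s :* (:- (V :* V :* DQ) :* V :+ V :* :- (V :* V :* DQ))
                        := s :* s :* (V :* V) :* (con -2ℚ :* DQ :* V)) refl s V (D Q) ⟩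
        s * s * (V * V) * (⟦ -2ℚ ⟧ * D Q * V)         ≈⟨ *-cong (sym DF) (*-congʳ (*-congˡ DQ)) ⟩
        D F * (⟦ -2ℚ ⟧ * ((1# + y) * (⟦ ℚ.½ ⟧ * s * C) − s * (⟦ ℚ.½ ⟧ * s * S)) * V)
          ≈⟨ *-congˡ (solve 6 (λ s S C V o y →
               con -2ℚ :* ((o :+ y) :* (con ℚ.½ :* s :* C) :- s :* (con ℚ.½ :* s :* S)) :* V
               := (s :* s :* S :- (o :+ y) :* (s :* C)) :* V) refl s S C V 1# y) ⟩
        D F * ((s * s * S − (1# + y) * (s * C)) * V)  ≈⟨ *-congˡ (*-congʳ (+-congʳ (*-congʳ s²))) ⟩
        D F * (((1# + y * y) * S − (1# + y) * (s * C)) * V)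
          -- The solver has treated `1#` as an opaque variable so far; the next identity needs it to
          -- act as a unit, so it becomes the scalar 1.
          ≈⟨ *-congˡ (*-congʳ (+-cong (*-congʳ (+-congʳ (sym 1-homo))) (-‿cong (*-congʳ (+-congʳ (sym 1-homo)))))) ⟩
        D F * (((⟦ ℚ.1ℚ ⟧ + y * y) * S − (⟦ ℚ.1ℚ ⟧ + y) * (s * C)) * V)
          ≈⟨ *-congˡ (solve 5 (λ s S C V y →
               ((con ℚ.1ℚ :+ y :* y) :* S :- (con ℚ.1ℚ :+ y) :* (s :* C)) :* V
               := (y :+ con ℚ.1ℚ) :* (V :* ((con ℚ.1ℚ :+ y) :* S :- s :* C)) :+ y :* (con -2ℚ :* S :* V)) refl s S C V y) ⟩
        D F * ((y + ⟦ ℚ.1ℚ ⟧) * (V * ((⟦ ℚ.1ℚ ⟧ + y) * S − s * C)) + y * F)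
          ≈⟨ *-congˡ (+-congʳ (*-cong (+-congˡ 1-homo) (*-congˡ (+-congʳ (*-congʳ (+-congʳ 1-homo)))))) ⟩
        D F * ((y + 1#) * (V * Q) + y * F)            ≈⟨ *-congˡ (+-congʳ (trans (*-congˡ VQ) (*-identityʳ _))) ⟩
        D F * (y + 1# + y * F)                        ≈⟨ *-congˡ (+-assoc _ _ _) ⟩
        D F * (y + (1# + y * F))                      ∎

open import Relation.Binary.PropositionalEquality using (_≢_; refl; sym; trans; cong; cong₂; subst; module ≡-Reasoning)
open import Data.Rational using (1ℚ; ½; _+_; _*_; -_)
open Equivalence using (to; from)

-- Rational coefficients and composition of series

-- ℚ[[y]] and its power series ring ℚ[[y]][[z]]; the carrier of the latter is Ser.
ℚRing ℚ⟦y⟧ ℚ⟦y⟧⟦z⟧ : CommutativeRing _ _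
ℚRing    = ℚ.+-*-commutativeRing
ℚ⟦y⟧    = PowerSeries.powerSeries ℚRing
ℚ⟦y⟧⟦z⟧ = PowerSeries.powerSeries ℚ⟦y⟧

module PY = PowerSeries ℚRing
module PZ = PowerSeries ℚ⟦y⟧
module Y = CommutativeRing ℚ⟦y⟧
module Z = CommutativeRing ℚ⟦y⟧⟦z⟧
module YMult = SemiringMult Y.semiring renaming (_×_ to _·_)
open SemiringMult (CommutativeRing.semiring ℚRing)
  using (×-assocˡ; ×-comm-*; ×-assoc-*; ×-congʳ)
  renaming (_×_ to _·_)
open CommutativeMonoidMult (CommutativeRing.+-commutativeMonoid ℚRing) using (×-distrib-+)

-- Rational coefficients: clearing denominators by repeated addition

toℚᵘ-/ : ∀ m d → ℚ.toℚᵘ (+ m / suc d) ℚᵘ.≃ ℚᵘ.mkℚᵘ (+ m) d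
toℚᵘ-/ m d = ℚ.toℚᵘ-fromℚᵘ (ℚᵘ.mkℚᵘ (+ m) d)

fromℕℚ-suc : ∀ n → fromℕℚ (suc n) ≡ 1ℚ + fromℕℚ n
fromℕℚ-suc n = ℚ.toℚᵘ-injective (begin
  ℚ.toℚᵘ (+ suc n / 1)                ≈⟨ toℚᵘ-/ (suc n) 0 ⟩
  ℚᵘ.mkℚᵘ (+ suc n) 0                 ≈⟨ ℚᵘ.*≡* (cong (λ k → (+ 1 ℤ.+ k) ℤ.* + 1) (sym (ℤ.*-identityʳ (+ n)))) ⟩
  ℚᵘ.1ℚᵘ ℚᵘ.+ ℚᵘ.mkℚᵘ (+ n) 0         ≈⟨ ℚᵘ.+-congʳ ℚᵘ.1ℚᵘ (toℚᵘ-/ n 0) ⟨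
  ℚ.toℚᵘ 1ℚ ℚᵘ.+ ℚ.toℚᵘ (fromℕℚ n)    ≈⟨ ℚ.toℚᵘ-homo-+ 1ℚ (fromℕℚ n) ⟨
  ℚ.toℚᵘ (1ℚ + fromℕℚ n)              ∎)
  where open SetoidReasoning ℚᵘ.≃-setoid

×≡fromℕℚ* : ∀ n q → n · q ≡ fromℕℚ n * q
×≡fromℕℚ* zero    q = sym (ℚ.*-zeroˡ q)
×≡fromℕℚ* (suc n) q = begin
  q + n · q               ≡⟨ cong₂ _+_ (sym (ℚ.*-identityˡ q)) (×≡fromℕℚ* n q) ⟩
  1ℚ * q + fromℕℚ n * q   ≡⟨ ℚ.*-distribʳ-+ q 1ℚ (fromℕℚ n) ⟨
  (1ℚ + fromℕℚ n) * q     ≡⟨ cong (_* q) (fromℕℚ-suc n) ⟨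
  fromℕℚ (suc n) * q      ∎
  where open ≡-Reasoning

-- Together with `×-cancelˡ` this determines a fraction by its multiple, so the factorials below are
-- handled by clearing denominators.
×-/ : ∀ m d .{{_ : ℕ.NonZero d}} → d · (+ m / d) ≡ m · 1ℚ
×-/ m d@(suc d-1) = trans (×≡fromℕℚ* d (+ m / d)) (trans (ℚ.toℚᵘ-injective (begin
  ℚ.toℚᵘ (fromℕℚ d * (+ m / d))                  ≈⟨ ℚ.toℚᵘ-homo-* (fromℕℚ d) (+ m / d) ⟩
  ℚ.toℚᵘ (fromℕℚ d) ℚᵘ.* ℚ.toℚᵘ (+ m / d)        ≈⟨ ℚᵘ.*-cong (toℚᵘ-/ d 0) (toℚᵘ-/ m d-1) ⟩
  ℚᵘ.mkℚᵘ (+ d) 0 ℚᵘ.* ℚᵘ.mkℚᵘ (+ m) d-1         ≈⟨ ℚᵘ.*≡* (trans (ℤ.*-identityʳ _) (trans (ℤ.*-comm (+ d) (+ m)) (cong (λ k → + m ℤ.* + suc k) (sym (ℕ.+-identityʳ d-1))))) ⟩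
  ℚᵘ.mkℚᵘ (+ m) 0                                ≈⟨ toℚᵘ-/ m 0 ⟨
  ℚ.toℚᵘ (fromℕℚ m)                              ∎))
  (sym (trans (×≡fromℕℚ* m 1ℚ) (ℚ.*-identityʳ _))))
  where open SetoidReasoning ℚᵘ.≃-setoid

fromℕℚ-suc≢0 : ∀ n → fromℕℚ (suc n) ≢ 0ℚ
fromℕℚ-suc≢0 n eq with ℚᵘ.≃-trans (ℚᵘ.≃-sym (toℚᵘ-/ (suc n) 0)) (ℚᵘ.≃-reflexive (cong ℚ.toℚᵘ eq))
... | ℚᵘ.*≡* ()

recip-*ˡ : ∀ {q} → q ≢ 0ℚ → recip q * q ≡ 1ℚ
recip-*ˡ {q} q≢0 with q ℚ.≟ 0ℚ
... | yes q≡0 = contradiction q≡0 q≢0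
... | no  q≢0 = ℚ.*-inverseˡ q {{ℚ.≢-nonZero q≢0}}

*-cancelˡ-≢0 : ∀ {q p r} → q ≢ 0ℚ → q * p ≡ q * r → p ≡ r
*-cancelˡ-≢0 {q} {p} {r} q≢0 qp≡qr = begin
  p                    ≡⟨ ℚ.*-identityˡ p ⟨
  1ℚ * p               ≡⟨ cong (_* p) (recip-*ˡ q≢0) ⟨
  recip q * q * p      ≡⟨ ℚ.*-assoc (recip q) q p ⟩
  recip q * (q * p)    ≡⟨ cong (recip q *_) qp≡qr ⟩
  recip q * (q * r)    ≡⟨ ℚ.*-assoc (recip q) q r ⟨
  recip q * q * r      ≡⟨ cong (_* r) (recip-*ˡ q≢0) ⟩
  1ℚ * r               ≡⟨ ℚ.*-identityˡ r ⟩
  r                    ∎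
  where open ≡-Reasoning

×-cancelˡ : ∀ n {p r} .{{_ : ℕ.NonZero n}} → n · p ≡ n · r → p ≡ r
×-cancelˡ n@(suc n-1) {p} {r} eq = *-cancelˡ-≢0 (fromℕℚ-suc≢0 n-1)
  (trans (sym (×≡fromℕℚ* n p)) (trans eq (×≡fromℕℚ* n r)))

×-invFact : ∀ n → suc n · invFact (suc n) ≡ invFact n
×-invFact n = ×-cancelˡ (n !) {{n ℕ.!≢0}} (begin
  (n !) · (suc n · invFact (suc n))  ≡⟨ ×-assocˡ (invFact (suc n)) (n !) (suc n) ⟩
  (n ! ℕ.* suc n) · invFact (suc n)  ≡⟨ cong (_· invFact (suc n)) (ℕ.*-comm (n !) (suc n)) ⟩
  (suc n !) · invFact (suc n)        ≡⟨ ×-/ 1 (suc n !) {{suc n ℕ.!≢0}} ⟩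
  1 · 1ℚ                             ≡⟨ ×-/ 1 (n !) {{n ℕ.!≢0}} ⟨
  (n !) · invFact n                  ∎)
  where open ≡-Reasoning

isEven-suc : ∀ n → isEven (suc n) ≡ not (isEven n)
isEven-suc zero          = refl
isEven-suc (suc zero)    = refl
isEven-suc (suc (suc n)) = isEven-suc n

-- The rule sinh′ = cosh read on coefficients; the next lemma is cosh′ = sinh.
sinhCoeff-suc : ∀ n → suc n · sinhCoeff (suc n) ≡ coshCoeff n
sinhCoeff-suc n with isEven n | isEven (suc n) | isEven-suc n
... | true  | .false | refl = ×-invFact n
... | false | .true  | refl = PY.×-0# (suc n)

coshCoeff-suc : ∀ n → suc n · coshCoeff (suc n) ≡ sinhCoeff n
coshCoeff-suc n with isEven n | isEven (suc n) | isEven-suc n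
... | false | .true  | refl = ×-invFact n
... | true  | .false | refl = PY.×-0# (suc n)

-- The coefficient form of 2 (1 + x) f′ = f, the differential equation of f = (1 + x)^(1/2).
halfChoose-suc : ∀ n → (2 ℕ.+ 2 ℕ.* n) · halfChoose (suc n) + (2 ℕ.* n) · halfChoose n ≡ halfChoose n
halfChoose-suc n = begin
  (2 ℕ.+ 2 ℕ.* n) · (hf * (½ + - q) * invFact (suc n)) + (2 ℕ.* n) · b
    ≡⟨ cong₂ _+_ (cong (_· (hf * (½ + - q) * invFact (suc n))) (sym (ℕ.*-suc 2 n))) (sym (×-assocˡ b 2 n)) ⟩
  (2 ℕ.* suc n) · (hf * (½ + - q) * invFact (suc n)) + 2 · (n · b)
    ≡⟨ cong (_+ (2 · (n · b))) (sym (×-assocˡ (hf * (½ + - q) * invFact (suc n)) 2 (suc n))) ⟩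
  2 · (suc n · (hf * (½ + - q) * invFact (suc n))) + 2 · (n · b)
    ≡⟨ cong₂ (λ u v → 2 · u + 2 · v) (trans (sym (×-comm-* (suc n) (hf * (½ + - q)) (invFact (suc n)))) (cong (hf * (½ + - q) *_) (×-invFact n))) (×≡fromℕℚ* n b) ⟩
  2 · (hf * (½ + - q) * invFact n) + 2 · (q * b)
    ≡⟨ ×-distrib-+ (hf * (½ + - q) * invFact n) (q * b) 2 ⟨
  2 · (hf * (½ + - q) * invFact n + q * b)
    ≡⟨ cong (2 ·_) (solve 4 (λ x q h i → h :* (x :+ :- q) :* i :+ q :* (h :* i) := x :* (h :* i)) refl ½ q hf (invFact n)) ⟩
  2 · (½ * b)
    ≡⟨ ×-assoc-* 2 ½ b ⟨
  1ℚ * b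
    ≡⟨ ℚ.*-identityˡ b ⟩
  b ∎
  where
  open ≡-Reasoning
  open ℚ.+-*-Solver
  hf = halfFalling n
  b = halfChoose n
  q = fromℕℚ n

-- Finite sums, products and composition of series

sumTo-cong : ∀ n {f g} → (∀ i → f i ≡ g i) → sumTo n f ≡ sumTo n g
sumTo-cong zero    eq = eq 0
sumTo-cong (suc n) eq = cong₂ _+_ (sumTo-cong n eq) (eq (suc n))

sumTo-0 : ∀ n {f} → (∀ i → i ℕ.≤ n → f i ≡ 0ℚ) → sumTo n f ≡ 0ℚ
sumTo-0 zero    eq = eq 0 z≤n
sumTo-0 (suc n) eq = cong₂ _+_ (sumTo-0 n (λ i → eq i ∘ ℕ.m≤n⇒m≤1+n)) (eq (suc n) ℕ.≤-refl)

sumTo-suc : ∀ n f → sumTo (suc n) f ≡ f 0 + sumTo n (f ∘ suc)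
sumTo-suc zero    f = refl
sumTo-suc (suc n) f = trans (cong (_+ f (suc (suc n))) (sumTo-suc n f)) (ℚ.+-assoc (f 0) (sumTo n (f ∘ suc)) (f (suc (suc n))))

sumTo-* : ∀ n c f → sumTo n (λ i → c * f i) ≡ c * sumTo n f
sumTo-* zero    c f = refl
sumTo-* (suc n) c f = trans (cong (_+ (c * f (suc n))) (sumTo-* n c f)) (sym (ℚ.*-distribˡ-+ c _ _))

sumTo-+ : ∀ n f g → sumTo n (λ i → f i + g i) ≡ sumTo n f + sumTo n g
sumTo-+ zero    f g = refl
sumTo-+ (suc n) f g = trans (cong (_+ (f (suc n) + g (suc n))) (sumTo-+ n f g)) (interchange (sumTo n f) (sumTo n g) (f (suc n)) (g (suc n)))
  where open CommutativeSemigroupProperties (CommutativeRing.+-commutativeSemigroup ℚRing)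

sumTo-⊛ : ∀ n f g → sumTo n (λ i → f i * g (n ∸ i)) ≡ (f PY.⊛ g) n
sumTo-⊛ zero    f g = refl
sumTo-⊛ (suc n) f g = trans (sumTo-suc n _) (cong (_+_ (f 0 * g (suc n))) (sumTo-⊛ n (tail f) g))

*ₛ≋⊛ : ∀ f g → (f *ₛ g) PZ.≋ (f PZ.⊛ g)
*ₛ≋⊛ f g n k = trans (sumTo-cong n (λ i → sumTo-⊛ k (f i) (g (n ∸ i)))) (outer n f)
  where
  outer : ∀ n f → sumTo n (λ i → (f i PY.⊛ g (n ∸ i)) k) ≡ (f PZ.⊛ g) n k
  outer zero    f = refl
  outer (suc n) f = trans (sumTo-suc n _) (cong (_+_ ((f 0 PY.⊛ g (suc n)) k)) (outer n (tail f)))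

-- The truncation bound in `compose` varies with the coefficient; this allows bounds to be exchanged
-- below a product.
*ₛ-local : ∀ w {f g} n k → (∀ p q → p ℕ.≤ n → q ℕ.≤ k → f p q ≡ g p q) → (w *ₛ f) n k ≡ (w *ₛ g) n k
*ₛ-local w n k eq = sumTo-cong n λ i → sumTo-cong k λ j →
  cong (w i j *_) (eq (n ∸ i) (k ∸ j) (ℕ.m∸n≤m n i) (ℕ.m∸n≤m k j))

*ₛ-scaleʳ : ∀ w c f n k → (w *ₛ scaleS c f) n k ≡ c * (w *ₛ f) n k
*ₛ-scaleʳ w c f n k = trans
  (sumTo-cong n λ i → trans (sumTo-cong k λ j → x∙yz≈y∙xz (w i j) c _) (sumTo-* k c _))
  (sumTo-* n c _)
  where open CommutativeSemigroupProperties (CommutativeRing.*-commutativeSemigroup ℚRing)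

*ₛ-distribˡ : ∀ w f g n k → (w *ₛ (f +ₛ g)) n k ≡ (w *ₛ f) n k + (w *ₛ g) n k
*ₛ-distribˡ w f g n k = trans
  (sumTo-cong n λ i → trans (sumTo-cong k λ j → ℚ.*-distribˡ-+ (w i j) _ _) (sumTo-+ k _ _))
  (sumTo-+ n _ _)

-- Induction on the exponent: in each term of the product either the factor is the zero constant
-- term of `w`, or it takes positive total degree and leaves too little for the remaining power.
powS-order : ∀ {w} → w 0 0 ≡ 0ℚ → ∀ m n k → n ℕ.+ k ℕ.< m → powS w m n k ≡ 0ℚ
powS-order {w} w₀ (suc m) n k (s≤s n+k≤m) = sumTo-0 n λ i i≤n → sumTo-0 k λ j j≤k → term i j i≤n j≤k
  where
  term : ∀ i j → i ℕ.≤ n → j ℕ.≤ k → w i j * powS w m (n ∸ i) (k ∸ j) ≡ 0ℚ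
  term zero zero i≤n j≤k = trans (cong (_* powS w m n k) w₀) (ℚ.*-zeroˡ (powS w m n k))
  term zero j@(suc _) i≤n j≤k = trans (cong (w 0 j *_) (powS-order {w} w₀ m n (k ∸ j)
    (ℕ.<-≤-trans (ℕ.+-monoʳ-< n (ℕ.∸-monoʳ-< (s≤s z≤n) j≤k)) n+k≤m))) (ℚ.*-zeroʳ (w 0 j))
  term i@(suc _) j i≤n j≤k = trans (cong (w i j *_) (powS-order {w} w₀ m (n ∸ i) (k ∸ j)
    (ℕ.<-≤-trans (ℕ.+-mono-<-≤ (ℕ.∸-monoʳ-< (s≤s z≤n) i≤n) (ℕ.m∸n≤m k j)) n+k≤m))) (ℚ.*-zeroʳ (w i j))

-- A bound common to all coefficients makes this a polynomial in `w`, to which Horner's rule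
-- (`composeTo-suc`) applies.
composeTo : ℕ → (ℕ → ℚ) → Ser → Ser
composeTo N a w n k = sumTo N (λ m → a m * powS w m n k)

composeTo-stable : ∀ {w} → w 0 0 ≡ 0ℚ → ∀ a N n k → n ℕ.+ k ℕ.≤ N → composeTo N a w n k ≡ compose a w n k
composeTo-stable w₀ a N n k n+k≤N with ℕ.m≤n⇒m<n∨m≡n n+k≤N
... | inj₂ refl = refl
composeTo-stable {w} w₀ a (suc N) n k _ | inj₁ (s≤s n+k≤N) = begin
  composeTo N a w n k + a (suc N) * powS w (suc N) n k
    ≡⟨ cong₂ _+_ (composeTo-stable {w} w₀ a N n k n+k≤N) (trans (cong (a (suc N) *_) (powS-order {w} w₀ (suc N) n k (s≤s n+k≤N))) (ℚ.*-zeroʳ (a (suc N)))) ⟩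
  compose a w n k + 0ℚ   ≡⟨ ℚ.+-identityʳ _ ⟩
  compose a w n k        ∎
  where open ≡-Reasoning

constS-scale : ∀ c n k → c * constS 1ℚ n k ≡ constS c n k
constS-scale c zero    zero    = ℚ.*-identityʳ c
constS-scale c zero    (suc k) = ℚ.*-zeroʳ c
constS-scale c (suc n) k       = ℚ.*-zeroʳ c

composeTo-suc : ∀ a w N n k → composeTo (suc N) a w n k ≡ constS (a 0) n k + (w *ₛ composeTo N (tail a) w) n k
composeTo-suc a w zero    n k = cong₂ _+_ (constS-scale (a 0) n k) (sym (*ₛ-scaleʳ w (a 1) (constS 1ℚ) n k))
composeTo-suc a w (suc N) n k = begin
  composeTo (suc N) a w n k + a (suc (suc N)) * powS w (suc (suc N)) n k
    ≡⟨ cong₂ _+_ (composeTo-suc a w N n k) (sym (*ₛ-scaleʳ w (a (suc (suc N))) (powS w (suc N)) n k)) ⟩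
  constS (a 0) n k + (w *ₛ composeTo N (tail a) w) n k + (w *ₛ scaleS (a (suc (suc N))) (powS w (suc N))) n k
    ≡⟨ ℚ.+-assoc (constS (a 0) n k) _ _ ⟩
  constS (a 0) n k + ((w *ₛ composeTo N (tail a) w) n k + (w *ₛ scaleS (a (suc (suc N))) (powS w (suc N))) n k)
    ≡⟨ cong (_+_ (constS (a 0) n k)) (*ₛ-distribˡ w (composeTo N (tail a) w) (scaleS (a (suc (suc N))) (powS w (suc N))) n k) ⟨
  constS (a 0) n k + (w *ₛ composeTo (suc N) (tail a) w) n k ∎
  where open ≡-Reasoning

-- Horner's rule in the limit: without a constant term in `w`, raising the truncation bound beyond n
-- + k changes nothing at degree (n, k).
compose-unfold : ∀ {w} → w 0 0 ≡ 0ℚ → ∀ a → compose a w PZ.≋ (constS (a 0) +ₛ (w PZ.⊛ compose (tail a) w))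
compose-unfold {w} w₀ a n k = begin
  -- One more term than needed, so that Horner's rule has a factor `w` to split off.
  compose a w n k                       ≡⟨ composeTo-stable {w} w₀ a (suc (n ℕ.+ k)) n k (ℕ.n≤1+n _) ⟨
  composeTo (suc (n ℕ.+ k)) a w n k     ≡⟨ composeTo-suc a w (n ℕ.+ k) n k ⟩
  constS (a 0) n k + (w *ₛ composeTo (n ℕ.+ k) (tail a) w) n k
    ≡⟨ cong (_+_ (constS (a 0) n k)) (*ₛ-local w n k λ p q p≤n q≤k → composeTo-stable {w} w₀ (tail a) (n ℕ.+ k) p q (ℕ.+-mono-≤ p≤n q≤k)) ⟩
  constS (a 0) n k + (w *ₛ compose (tail a) w) n k   ≡⟨ cong (_+_ (constS (a 0) n k)) (*ₛ≋⊛ w _ n k) ⟩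
  constS (a 0) n k + (w PZ.⊛ compose (tail a) w) n k ∎
  where open ≡-Reasoning

×-pointwise : ∀ n a k → (n YMult.· a) k ≡ n · a k
×-pointwise zero    a k = refl
×-pointwise (suc n) a k = cong (_+_ (a k)) (×-pointwise n a k)

-- Formal integration in characteristic 0: the factor `suc n` in the derivative can be cancelled.
∂-injective : ∀ {f g} → PZ.∂ f PZ.≋ PZ.∂ g → f 0 PY.≋ g 0 → f PZ.≋ g
∂-injective ∂f≋∂g f₀ zero    k = f₀ k
∂-injective {f} {g} ∂f≋∂g f₀ (suc n) k = ×-cancelˡ (suc n) (begin
  suc n · f (suc n) k            ≡⟨ ×-pointwise (suc n) (f (suc n)) k ⟨
  (suc n YMult.· f (suc n)) k    ≡⟨ ∂f≋∂g n k ⟩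
  (suc n YMult.· g (suc n)) k    ≡⟨ ×-pointwise (suc n) (g (suc n)) k ⟩
  suc n · g (suc n) k            ∎)
  where open ≡-Reasoning

-- Scalars and indeterminates of the statement inside ℚ[[y]][[z]]

⟦_⟧ : ℚ → Ser
⟦ q ⟧ = PZ.const (PY.const q)

scalars : ℚ.+-*-rawRing -Raw-AlmostCommutative⟶ fromCommutativeRing ℚ⟦y⟧⟦z⟧
scalars = record
  { ⟦_⟧    = ⟦_⟧
  ; +-homo = λ { p q zero zero → refl ; p q zero (suc k) → refl ; p q (suc n) k → refl }
  ; *-homo = λ p q n k → sym (trans (PZ.const-⊛ (PY.const p) ⟦ q ⟧ n k) (trans (PY.const-⊛ p (⟦ q ⟧ n) k) (*-scalar p q n k)))
  ; -‿homo = λ { p zero zero → refl ; p zero (suc k) → refl ; p (suc n) k → refl }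
  ; 0-homo = λ { zero zero → refl ; zero (suc k) → refl ; (suc n) k → refl }
  ; 1-homo = λ _ _ → refl
  }
  where
  *-scalar : ∀ p q n k → p * ⟦ q ⟧ n k ≡ ⟦ p * q ⟧ n k
  *-scalar p q zero    zero    = refl
  *-scalar p q zero    (suc k) = ℚ.*-zeroʳ p
  *-scalar p q (suc n) k       = ℚ.*-zeroʳ p

constS≋ : ∀ c → constS c PZ.≋ ⟦ c ⟧
constS≋ c zero    zero    = refl
constS≋ c zero    (suc k) = refl
constS≋ c (suc n) k       = refl

scaleS≋ : ∀ c f → scaleS c f PZ.≋ (⟦ c ⟧ PZ.⊛ f)
scaleS≋ c f n k = sym (trans (PZ.const-⊛ (PY.const c) f n k) (PY.const-⊛ c (f n) k))

zS≋X : zS PZ.≋ PZ.X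
zS≋X zero          k       = refl
zS≋X (suc zero)    zero    = refl
zS≋X (suc zero)    (suc k) = refl
zS≋X (suc (suc n)) k       = refl

yS≋X : yS PZ.≋ PZ.const PY.X
yS≋X zero    zero          = refl
yS≋X zero    (suc zero)    = refl
yS≋X zero    (suc (suc k)) = refl
yS≋X (suc n) k             = refl

yS-⊛ : ∀ f n → (yS PZ.⊛ f) n PY.≋ (PY.X PY.⊛ f n)
yS-⊛ f n k = trans (PZ.⊛-cong {g = f} yS≋X Z.refl n k) (PZ.const-⊛ PY.X f n k)

yS²-⊛ : ∀ f n → ((yS *ₛ yS) PZ.⊛ f) n PY.≋ (PY.X PY.⊛ (PY.X PY.⊛ f n))
yS²-⊛ f n = begin
  ((yS *ₛ yS) PZ.⊛ f) n       ≈⟨ PZ.⊛-cong {g = f} (*ₛ≋⊛ yS yS) Z.refl n ⟩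
  ((yS PZ.⊛ yS) PZ.⊛ f) n     ≈⟨ PZ.⊛-assoc yS yS f n ⟩
  (yS PZ.⊛ (yS PZ.⊛ f)) n     ≈⟨ yS-⊛ (yS PZ.⊛ f) n ⟩
  PY.X PY.⊛ (yS PZ.⊛ f) n     ≈⟨ PY.⊛-cong {f = PY.X} Y.refl (yS-⊛ f n) ⟩
  PY.X PY.⊛ (PY.X PY.⊛ f n)   ∎
  where open SetoidReasoning Y.setoid

X²-⊛-1 : ∀ g → (PY.X PY.⊛ (PY.X PY.⊛ g)) 1 ≡ 0ℚ
X²-⊛-1 g = trans (PY.X-⊛-suc (PY.X PY.⊛ g) Y.refl 0) (PY.X-⊛-zero g Y.refl)

X²-⊛-suc² : ∀ g k → (PY.X PY.⊛ (PY.X PY.⊛ g)) (suc (suc k)) ≡ g k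
X²-⊛-suc² g k = trans (PY.X-⊛-suc (PY.X PY.⊛ g) Y.refl (suc k)) (PY.X-⊛-suc g Y.refl k)

module _ (a : ℕ → ℚ) where
  private
    composed = compose (tail a) (yS *ₛ yS)
    step : ∀ n k → compose a (yS *ₛ yS) n k ≡ constS (a 0) n k + (PY.X PY.⊛ (PY.X PY.⊛ composed n)) k
    step n k = trans (compose-unfold {yS *ₛ yS} refl a n k) (cong (_+_ (constS (a 0) n k)) (yS²-⊛ composed n k))

  compose-y²-0 : ∀ n → compose a (yS *ₛ yS) n 0 ≡ constS (a 0) n 0
  compose-y²-0 n = trans (step n 0) (trans (cong (_+_ (constS (a 0) n 0)) (PY.X-⊛-zero (PY.X PY.⊛ composed n) Y.refl)) (ℚ.+-identityʳ _))

  compose-y²-1 : ∀ n → compose a (yS *ₛ yS) n 1 ≡ constS (a 0) n 1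
  compose-y²-1 n = trans (step n 1) (trans (cong (_+_ (constS (a 0) n 1)) (X²-⊛-1 (composed n))) (ℚ.+-identityʳ _))

  -- The factor y² shifts the exponent by two while the constant term of `a` is dropped; inductions
  -- on k thus go in steps of two and replace `a` by `tail a`.
  compose-y²-suc² : ∀ n k → compose a (yS *ₛ yS) n (suc (suc k)) ≡ composed n k
  compose-y²-suc² n k = trans (step n (suc (suc k))) (trans (cong₂ _+_ (constS-suc n) (X²-⊛-suc² (composed n) k)) (ℚ.+-identityˡ _))
    where
    constS-suc : ∀ n → constS (a 0) n (suc (suc k)) ≡ 0ℚ
    constS-suc zero    = refl
    constS-suc (suc n) = refl

compose-y²-suc : ∀ a n k → compose a (yS *ₛ yS) (suc n) k ≡ 0ℚ
compose-y²-suc a n zero          = compose-y²-0 a (suc n)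
compose-y²-suc a n (suc zero)    = compose-y²-1 a (suc n)
compose-y²-suc a n (suc (suc k)) = trans (compose-y²-suc² a (suc n) k) (compose-y²-suc (tail a) n k)

-- (1 + y²) y f′ = y² f for f = a(y²), read off the recurrence of the coefficients a m;
-- the offset p makes the claim hereditary under a ↦ tail a.
compose-y²-recurrence : ∀ p a b →
  (∀ m → (2 ℕ.+ (p ℕ.+ 2 ℕ.* m)) · b m + (p ℕ.+ 2 ℕ.* m) · a m ≡ a m) →
  ∀ k → (2 ℕ.+ (p ℕ.+ k)) · compose b (yS *ₛ yS) 0 k + (p ℕ.+ k) · compose a (yS *ₛ yS) 0 k
        ≡ compose a (yS *ₛ yS) 0 k
compose-y²-recurrence p a b rec zero = begin
  (2 ℕ.+ (p ℕ.+ 0)) · compose b (yS *ₛ yS) 0 0 + (p ℕ.+ 0) · compose a (yS *ₛ yS) 0 0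
    ≡⟨ cong₂ (λ u v → (2 ℕ.+ (p ℕ.+ 0)) · u + (p ℕ.+ 0) · v) (compose-y²-0 b 0) (compose-y²-0 a 0) ⟩
  (2 ℕ.+ (p ℕ.+ 0)) · b 0 + (p ℕ.+ 0) · a 0   ≡⟨ rec 0 ⟩
  a 0                                         ≡⟨ compose-y²-0 a 0 ⟨
  compose a (yS *ₛ yS) 0 0                    ∎
  where open ≡-Reasoning
compose-y²-recurrence p a b rec (suc zero) = begin
  (2 ℕ.+ (p ℕ.+ 1)) · compose b (yS *ₛ yS) 0 1 + (p ℕ.+ 1) · compose a (yS *ₛ yS) 0 1
    ≡⟨ cong₂ (λ u v → (2 ℕ.+ (p ℕ.+ 1)) · u + (p ℕ.+ 1) · v) (compose-y²-1 b 0) (compose-y²-1 a 0) ⟩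
  (2 ℕ.+ (p ℕ.+ 1)) · 0ℚ + (p ℕ.+ 1) · 0ℚ   ≡⟨ cong₂ _+_ (PY.×-0# (2 ℕ.+ (p ℕ.+ 1))) (PY.×-0# (p ℕ.+ 1)) ⟩
  0ℚ                                        ≡⟨ compose-y²-1 a 0 ⟨
  compose a (yS *ₛ yS) 0 1                  ∎
  where open ≡-Reasoning
compose-y²-recurrence p a b rec (suc (suc k)) = begin
  (2 ℕ.+ (p ℕ.+ (2 ℕ.+ k))) · compose b (yS *ₛ yS) 0 (2 ℕ.+ k) + (p ℕ.+ (2 ℕ.+ k)) · compose a (yS *ₛ yS) 0 (2 ℕ.+ k)
    ≡⟨ cong₂ (λ u v → (2 ℕ.+ (p ℕ.+ (2 ℕ.+ k))) · u + (p ℕ.+ (2 ℕ.+ k)) · v) (compose-y²-suc² b 0 k) (compose-y²-suc² a 0 k) ⟩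
  (2 ℕ.+ (p ℕ.+ (2 ℕ.+ k))) · compose (tail b) (yS *ₛ yS) 0 k + (p ℕ.+ (2 ℕ.+ k)) · compose (tail a) (yS *ₛ yS) 0 k
    ≡⟨ cong (λ j → (2 ℕ.+ j) · compose (tail b) (yS *ₛ yS) 0 k + j · compose (tail a) (yS *ₛ yS) 0 k) (+-suc² p k) ⟩
  (2 ℕ.+ (2 ℕ.+ p ℕ.+ k)) · compose (tail b) (yS *ₛ yS) 0 k + (2 ℕ.+ p ℕ.+ k) · compose (tail a) (yS *ₛ yS) 0 k
    ≡⟨ compose-y²-recurrence (2 ℕ.+ p) (tail a) (tail b) rec′ k ⟩
  compose (tail a) (yS *ₛ yS) 0 k     ≡⟨ compose-y²-suc² a 0 k ⟨
  compose a (yS *ₛ yS) 0 (2 ℕ.+ k)    ∎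
  where
  open ≡-Reasoning
  +-suc² : ∀ p k → p ℕ.+ (2 ℕ.+ k) ≡ 2 ℕ.+ p ℕ.+ k
  +-suc² p k = trans (ℕ.+-suc p (suc k)) (cong suc (ℕ.+-suc p k))
  rec′ : ∀ m → (2 ℕ.+ (2 ℕ.+ p ℕ.+ 2 ℕ.* m)) · tail b m + (2 ℕ.+ p ℕ.+ 2 ℕ.* m) · tail a m ≡ tail a m
  rec′ m = subst (λ j → (2 ℕ.+ j) · tail b m + j · tail a m ≡ tail a m)
    (trans (cong (p ℕ.+_) (ℕ.*-suc 2 m)) (+-suc² p (2 ℕ.* m))) (rec (suc m))

-- The square root of 1 + y²

√ : ℕ → ℚ
√ = sqrtY 0

sqrtY≋const : sqrtY PZ.≋ PZ.const √
sqrtY≋const zero    k = refl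
sqrtY≋const (suc n) k = compose-y²-suc halfChoose n k

√-recurrence : ∀ k → PY.θ √ (suc (suc k)) + PY.θ √ k ≡ √ k
√-recurrence k = trans
  (cong (λ u → (2 ℕ.+ k) · u + k · √ k) (compose-y²-suc² halfChoose 0 k))
  (compose-y²-recurrence 0 halfChoose (tail halfChoose) halfChoose-suc k)

-- The hypothesis says (1 + y²) θf = y² f. Since θ(f²) = 2 f θf, multiplying it by 2f gives (1 + y²)
-- θ(f²) = 2 y² f², and no convolution of binomial coefficients has to be evaluated.
square-recurrence : ∀ f → f 1 ≡ 0ℚ → (∀ k → PY.θ f (suc (suc k)) + PY.θ f k ≡ f k) →
  ∀ k → suc (suc k) · (f PY.⊛ f) (suc (suc k)) + k · (f PY.⊛ f) k ≡ 2 · (f PY.⊛ f) k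
square-recurrence f f₁≡0 rec k = begin
  PY.θ (f PY.⊛ f) (2 ℕ.+ k) + PY.θ (f PY.⊛ f) k
    ≡⟨ cong₂ _+_ (θ-square (2 ℕ.+ k)) (θ-square k) ⟩
  2 · (f PY.⊛ g) (2 ℕ.+ k) + 2 · (f PY.⊛ g) k
    ≡⟨ ×-distrib-+ ((f PY.⊛ g) (2 ℕ.+ k)) ((f PY.⊛ g) k) 2 ⟨
  2 · ((f PY.⊛ g) (2 ℕ.+ k) + (f PY.⊛ g) k)
    -- Two shifts of `g` split off boundary terms with `g 0` and `g 1`. The first vanishes because θ
    -- annihilates constants, the second because f 1 = 0.
    ≡⟨ cong (λ u → 2 · (u + (f PY.⊛ g) k)) (trans (PY.⊛-suc-last f g (suc k)) (drop-0 ((f PY.⊛ tail g) (suc k)) (f (2 ℕ.+ k)) refl)) ⟩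
  2 · ((f PY.⊛ tail g) (suc k) + (f PY.⊛ g) k)
    ≡⟨ cong (λ u → 2 · (u + (f PY.⊛ g) k)) (trans (PY.⊛-suc-last f (tail g) k) (drop-0 ((f PY.⊛ tail (tail g)) k) (f (1 ℕ.+ k)) (cong (1 ·_) f₁≡0))) ⟩
  2 · ((f PY.⊛ tail (tail g)) k + (f PY.⊛ g) k)
    ≡⟨ cong (2 ·_) (Y.distribˡ f (tail (tail g)) g k) ⟨
  2 · (f PY.⊛ (λ i → g (2 ℕ.+ i) + g i)) k
    ≡⟨ cong (2 ·_) (PY.⊛-cong {f = f} Y.refl rec k) ⟩
  2 · (f PY.⊛ f) k ∎
  where
  open ≡-Reasoning
  g : ℕ → ℚ
  g = PY.θ f
  drop-0 : ∀ u c {v} → v ≡ 0ℚ → u + c * v ≡ u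
  drop-0 u c refl = trans (cong (_+_ u) (ℚ.*-zeroʳ c)) (ℚ.+-identityʳ u)
  θ-square : ∀ n → PY.θ (f PY.⊛ f) n ≡ 2 · (f PY.⊛ g) n
  θ-square n = trans (PY.θ-⊛ f f n) (trans (cong (_+ (f PY.⊛ g) n) (PY.⊛-comm g f n)) (cong (_+_ ((f PY.⊛ g) n)) (sym (ℚ.+-identityʳ ((f PY.⊛ g) n)))))

√² : ℕ → ℚ
√² = √ PY.⊛ √

√²-recurrence : ∀ k → suc (suc k) · √² (suc (suc k)) + k · √² k ≡ 2 · √² k
√²-recurrence = square-recurrence √ refl √-recurrence

-- The recurrence links indices of equal parity and propagates zeros upwards. Coefficients 3 and 4,
-- evaluated directly, start the two parities; below them the coefficients are compared by
-- evaluation.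
√²≋1+X² : √² PY.≋ λ k → PY.const 1ℚ k + (PY.X PY.⊛ PY.X) k
√²≋1+X² zero                = refl
√²≋1+X² (suc zero)          = refl
√²≋1+X² (suc (suc zero))    = refl
√²≋1+X² (suc (suc (suc k))) = trans (vanish k) (sym (trans (ℚ.+-identityˡ _) (trans (PY.X-⊛-suc PY.X Y.refl (suc (suc k))) refl)))
  where
  vanish : ∀ k → √² (3 ℕ.+ k) ≡ 0ℚ
  vanish zero = refl
  vanish (suc zero) = refl
  vanish (suc (suc k)) = ×-cancelˡ (5 ℕ.+ k) (begin
    (5 ℕ.+ k) · √² (5 ℕ.+ k)                                ≡⟨ ℚ.+-identityʳ ((5 ℕ.+ k) · √² (5 ℕ.+ k)) ⟨
    (5 ℕ.+ k) · √² (5 ℕ.+ k) + 0ℚ                           ≡⟨ cong (_+_ ((5 ℕ.+ k) · √² (5 ℕ.+ k))) (PY.×-0# (3 ℕ.+ k)) ⟨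
    (5 ℕ.+ k) · √² (5 ℕ.+ k) + (3 ℕ.+ k) · 0ℚ               ≡⟨ cong (λ u → (5 ℕ.+ k) · √² (5 ℕ.+ k) + (3 ℕ.+ k) · u) (vanish k) ⟨
    (5 ℕ.+ k) · √² (5 ℕ.+ k) + (3 ℕ.+ k) · √² (3 ℕ.+ k)     ≡⟨ √²-recurrence (3 ℕ.+ k) ⟩
    2 · √² (3 ℕ.+ k)                                        ≡⟨ cong (2 ·_) (vanish k) ⟩
    0ℚ                                                      ≡⟨ PY.×-0# (5 ℕ.+ k) ⟨
    (5 ℕ.+ k) · 0ℚ                                          ∎)
    where open ≡-Reasoning

-- The right-hand side

open CommutativeRing ℚ⟦y⟧⟦z⟧ using (_-_)

differentialSeries : DifferentialℚAlgebra
differentialSeries = record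
  { commutativeRing = ℚ⟦y⟧⟦z⟧
  ; scalars         = scalars
  ; D               = PZ.∂
  ; D-cong          = PZ.∂-cong
  ; D-+             = PZ.∂-+
  ; D-*             = PZ.∂-⊛
  ; D-scalar        = λ q → PZ.∂-const (PY.const q)
  }

open RiccatiEquation differentialSeries

-- Hyperbolic sine and cosine of `wS`

wS-0 : wS 0 PY.≋ λ _ → 0ℚ
wS-0 k = cong (½ *_) (trans (*ₛ≋⊛ zS sqrtY 0 k) (PZ.X-⊛-zero sqrtY zS≋X k))

wS-suc : tail wS PZ.≋ (⟦ ½ ⟧ PZ.⊛ sqrtY)
wS-suc n k = begin
  ½ * (zS *ₛ sqrtY) (suc n) k    ≡⟨ cong (½ *_) (*ₛ≋⊛ zS sqrtY (suc n) k) ⟩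
  ½ * (zS PZ.⊛ sqrtY) (suc n) k  ≡⟨ cong (½ *_) (PZ.X-⊛-suc sqrtY zS≋X n k) ⟩
  ½ * sqrtY n k                  ≡⟨ scaleS≋ ½ sqrtY n k ⟩
  (⟦ ½ ⟧ PZ.⊛ sqrtY) n k         ∎
  where open ≡-Reasoning

½√ : ℕ → ℚ
½√ = PY.const ½ PY.⊛ √

½sqrtY-⊛ : ∀ f n → ((⟦ ½ ⟧ PZ.⊛ sqrtY) PZ.⊛ f) n PY.≋ (½√ PY.⊛ f n)
½sqrtY-⊛ f n = begin
  ((⟦ ½ ⟧ PZ.⊛ sqrtY) PZ.⊛ f) n       ≈⟨ PZ.⊛-cong {g = f} (PZ.⊛-cong {f = ⟦ ½ ⟧} Z.refl sqrtY≋const) Z.refl n ⟩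
  ((⟦ ½ ⟧ PZ.⊛ PZ.const √) PZ.⊛ f) n  ≈⟨ PZ.⊛-assoc ⟦ ½ ⟧ (PZ.const √) f n ⟩
  (⟦ ½ ⟧ PZ.⊛ (PZ.const √ PZ.⊛ f)) n  ≈⟨ PZ.const-⊛ (PY.const ½) (PZ.const √ PZ.⊛ f) n ⟩
  PY.const ½ PY.⊛ (PZ.const √ PZ.⊛ f) n ≈⟨ PY.⊛-cong {f = PY.const ½} Y.refl (PZ.const-⊛ √ f n) ⟩
  PY.const ½ PY.⊛ (√ PY.⊛ f n)        ≈⟨ PY.⊛-assoc (PY.const ½) √ (f n) ⟨
  ½√ PY.⊛ f n                         ∎
  where open SetoidReasoning Y.setoid

compose-wS-0 : ∀ a → compose a wS 0 PY.≋ PY.const (a 0)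
compose-wS-0 a k = begin
  compose a wS 0 k                                 ≡⟨ compose-unfold {wS} (wS-0 0) a 0 k ⟩
  constS (a 0) 0 k + (wS 0 PY.⊛ compose (tail a) wS 0) k  ≡⟨ cong (_+_ (constS (a 0) 0 k)) (PY.⊛-zeroˡ (compose (tail a) wS 0) wS-0 k) ⟩
  constS (a 0) 0 k + 0ℚ                            ≡⟨ ℚ.+-identityʳ (constS (a 0) 0 k) ⟩
  constS (a 0) 0 k                                 ≡⟨ constS≋ (a 0) 0 k ⟩
  PY.const (a 0) k                                 ∎
  where open ≡-Reasoning

-- As w is z times the z-free series ½√, the factor w in `compose-unfold` lowers the z-degree by one
-- and contributes ½√.
compose-wS-suc : ∀ a n → compose a wS (suc n) PY.≋ (½√ PY.⊛ compose (tail a) wS n)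
compose-wS-suc a n k = begin
  compose a wS (suc n) k                       ≡⟨ compose-unfold {wS} (wS-0 0) a (suc n) k ⟩
  0ℚ + ((wS 0 PY.⊛ f (suc n)) k + (tail wS PZ.⊛ f) n k)  ≡⟨ ℚ.+-identityˡ _ ⟩
  (wS 0 PY.⊛ f (suc n)) k + (tail wS PZ.⊛ f) n k  ≡⟨ cong₂ _+_ (PY.⊛-zeroˡ (f (suc n)) wS-0 k) (PZ.⊛-cong {g = f} wS-suc Z.refl n k) ⟩
  0ℚ + ((⟦ ½ ⟧ PZ.⊛ sqrtY) PZ.⊛ f) n k         ≡⟨ ℚ.+-identityˡ _ ⟩
  ((⟦ ½ ⟧ PZ.⊛ sqrtY) PZ.⊛ f) n k              ≡⟨ ½sqrtY-⊛ f n k ⟩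
  (½√ PY.⊛ f n) k                              ∎
  where
  open ≡-Reasoning
  f = compose (tail a) wS

-- Each step lowers n by one and passes to `tail a`; the offset p grows by one to keep the
-- multiplier p + n fixed.
compose-wS-scale : ∀ p a b → (∀ m → (p ℕ.+ m) · a m ≡ b m) →
  ∀ n → ((p ℕ.+ n) YMult.· compose a wS n) PY.≋ compose b wS n
compose-wS-scale p a b eq zero k = begin
  ((p ℕ.+ 0) YMult.· compose a wS 0) k    ≡⟨ ×-pointwise (p ℕ.+ 0) (compose a wS 0) k ⟩
  (p ℕ.+ 0) · compose a wS 0 k            ≡⟨ ×-congʳ (p ℕ.+ 0) (compose-wS-0 a k) ⟩
  (p ℕ.+ 0) · PY.const (a 0) k            ≡⟨ const-× k ⟩
  PY.const (b 0) k                        ≡⟨ compose-wS-0 b k ⟨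
  compose b wS 0 k                        ∎
  where
  open ≡-Reasoning
  const-× : ∀ k → (p ℕ.+ 0) · PY.const (a 0) k ≡ PY.const (b 0) k
  const-× zero    = eq 0
  const-× (suc k) = PY.×-0# (p ℕ.+ 0)
compose-wS-scale p a b eq (suc n) = begin
  (p ℕ.+ suc n) YMult.· compose a wS (suc n)             ≈⟨ YMult.×-congʳ (p ℕ.+ suc n) (compose-wS-suc a n) ⟩
  (p ℕ.+ suc n) YMult.· (½√ PY.⊛ compose (tail a) wS n)  ≡⟨ cong (YMult._· (½√ PY.⊛ compose (tail a) wS n)) (ℕ.+-suc p n) ⟩
  (suc p ℕ.+ n) YMult.· (½√ PY.⊛ compose (tail a) wS n)  ≈⟨ YMult.×-comm-* (suc p ℕ.+ n) ½√ (compose (tail a) wS n) ⟨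
  ½√ PY.⊛ (suc p ℕ.+ n) YMult.· compose (tail a) wS n    ≈⟨ PY.⊛-cong {f = ½√} Y.refl (compose-wS-scale (suc p) (tail a) (tail b) eq′ n) ⟩
  ½√ PY.⊛ compose (tail b) wS n                          ≈⟨ compose-wS-suc b n ⟨
  compose b wS (suc n)                                   ∎
  where
  open SetoidReasoning Y.setoid
  eq′ : ∀ m → (suc p ℕ.+ m) · tail a m ≡ tail b m
  eq′ m = trans (cong (_· a (suc m)) (sym (ℕ.+-suc p m))) (eq (suc m))

-- The chain rule for w = ½ s z, where w′ = ½ s is free of z. Offset 1 in `compose-wS-scale` turns
-- `tail a` into the coefficients of a′.
∂-compose-wS : ∀ a b → (∀ m → suc m · a (suc m) ≡ b m) →
  PZ.∂ (compose a wS) PZ.≋ ((⟦ ½ ⟧ PZ.⊛ sqrtY) PZ.⊛ compose b wS)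
∂-compose-wS a b eq n = begin
  suc n YMult.· compose a wS (suc n)                ≈⟨ YMult.×-congʳ (suc n) (compose-wS-suc a n) ⟩
  suc n YMult.· (½√ PY.⊛ compose (tail a) wS n)     ≈⟨ YMult.×-comm-* (suc n) ½√ (compose (tail a) wS n) ⟨
  ½√ PY.⊛ (suc n YMult.· compose (tail a) wS n)     ≈⟨ PY.⊛-cong {f = ½√} Y.refl (compose-wS-scale 1 (tail a) b eq n) ⟩
  ½√ PY.⊛ compose b wS n                            ≈⟨ ½sqrtY-⊛ (compose b wS) n ⟨
  ((⟦ ½ ⟧ PZ.⊛ sqrtY) PZ.⊛ compose b wS) n          ∎
  where open SetoidReasoning Y.setoid

∂-sinhW : PZ.∂ sinhW PZ.≋ ((⟦ ½ ⟧ PZ.⊛ sqrtY) PZ.⊛ coshW)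
∂-sinhW = ∂-compose-wS sinhCoeff coshCoeff sinhCoeff-suc

∂-coshW : PZ.∂ coshW PZ.≋ ((⟦ ½ ⟧ PZ.⊛ sqrtY) PZ.⊛ sinhW)
∂-coshW = ∂-compose-wS coshCoeff sinhCoeff coshCoeff-suc

sinhW-0 : sinhW 0 PY.≋ λ _ → 0ℚ
sinhW-0 k = trans (compose-wS-0 sinhCoeff k) (const-0 k)
  where
  const-0 : ∀ k → PY.const 0ℚ k ≡ 0ℚ
  const-0 zero    = refl
  const-0 (suc k) = refl

coshW-0 : coshW 0 PY.≋ PY.const 1ℚ
coshW-0 = compose-wS-0 coshCoeff

cosh²≋1+sinh² : (coshW PZ.⊛ coshW) PZ.≋ (Z.1# +ₛ (sinhW PZ.⊛ sinhW))
cosh²≋1+sinh² = ∂-injective (D-cosh² {sqrtY} {sinhW} {coshW} ∂-sinhW ∂-coshW) (begin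
  coshW 0 PY.⊛ coshW 0                  ≈⟨ PY.⊛-cong coshW-0 coshW-0 ⟩
  PY.const 1ℚ PY.⊛ PY.const 1ℚ          ≈⟨ PY.⊛-identityˡ (PY.const 1ℚ) ⟩
  PY.const 1ℚ                           ≈⟨ Y.+-identityʳ (PY.const 1ℚ) ⟨
  PY.const 1ℚ Y.+ Y.0#                  ≈⟨ Y.+-congˡ {PY.const 1ℚ} (PY.⊛-zeroˡ (sinhW 0) sinhW-0) ⟨
  PY.const 1ℚ Y.+ sinhW 0 PY.⊛ sinhW 0  ∎)
  where open SetoidReasoning Y.setoid

sqrtY² : (sqrtY PZ.⊛ sqrtY) PZ.≋ (Z.1# +ₛ (yS PZ.⊛ yS))
sqrtY² zero    k = trans (√²≋1+X² k) (cong (_+_ (PY.const 1ℚ k)) (sym (PY.⊛-cong (yS≋X 0) (yS≋X 0) k)))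
sqrtY² (suc n) k = trans (PZ.⊛-cong {g = sqrtY} sqrtY≋const Z.refl (suc n) k) (trans (PZ.const-⊛ √ sqrtY (suc n) k)
  (trans (trans (PY.⊛-comm √ (sqrtY (suc n)) k) (PY.⊛-zeroˡ √ (sqrtY≋const (suc n)) k))
    (sym (trans (ℚ.+-identityˡ _) (trans (yS-⊛ yS (suc n) k) (trans (PY.⊛-comm PY.X (yS (suc n)) k) (PY.⊛-zeroˡ PY.X (yS≋X (suc n)) k)))))))

∂-yS : PZ.∂ yS PZ.≋ λ _ _ → 0ℚ
∂-yS n k = trans (PZ.∂-cong yS≋X n k) (PZ.∂-const PY.X n k)

∂-sqrtY : PZ.∂ sqrtY PZ.≋ λ _ _ → 0ℚ
∂-sqrtY n k = trans (PZ.∂-cong sqrtY≋const n k) (PZ.∂-const √ n k)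

-- The geometric series P in u = 1 - f/c satisfies P = 1 + u P, so (f/c) P = P - u P = 1; a nonzero
-- c makes the constant term of u vanish.
invS-inverseˡ : ∀ f → f 0 0 ≢ 0ℚ → (invS f PZ.⊛ f) PZ.≋ Z.1#
invS-inverseˡ f f₀≢0 = begin
  invS f Z.* f                ≈⟨ Z.*-congʳ {f} (scaleS≋ (recip c) P) ⟩
  -- `Z.1#` is a variable `o` for the solver; the last bracket compensates for `o` not being known
  -- to be the unit.
  ⟦ recip c ⟧ Z.* P Z.* f     ≈⟨ solve 4 (λ r P f o → r :* P :* f := P :- (o :- r :* f) :* P :+ (o :* P :- P)) Z.refl ⟦ recip c ⟧ P f Z.1# ⟩
  (P - (Z.1# - ⟦ recip c ⟧ Z.* f) Z.* P) Z.+ (Z.1# Z.* P - P)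
    ≈⟨ Z.+-cong (Z.+-congʳ unfold) (Z.+-congʳ {Z.- P} (Z.*-identityˡ P)) ⟩
  ((Z.1# Z.+ (Z.1# - ⟦ recip c ⟧ Z.* f) Z.* P) - (Z.1# - ⟦ recip c ⟧ Z.* f) Z.* P) Z.+ (P - P)
    ≈⟨ solve 3 (λ o u P → o :+ u :- u :+ (P :- P) := o) Z.refl Z.1# ((Z.1# - ⟦ recip c ⟧ Z.* f) Z.* P) P ⟩
  Z.1#                        ∎
  where
  open SetoidReasoning Z.setoid
  c = f 0 0
  u = constS 1ℚ -ₛ scaleS (recip c) f
  P = compose (λ _ → 1ℚ) u
  u₀ : u 0 0 ≡ 0ℚ
  u₀ = trans (cong (λ x → 1ℚ + - x) (recip-*ˡ f₀≢0)) refl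
  unfold : P Z.≈ Z.1# Z.+ (Z.1# - ⟦ recip c ⟧ Z.* f) Z.* P
  unfold = Z.trans (compose-unfold {u} u₀ (λ _ → 1ℚ)) (Z.+-cong (constS≋ 1ℚ)
    (Z.*-congʳ {P} (Z.+-cong (constS≋ 1ℚ) (Z.-‿cong (scaleS≋ (recip c) f)))))

-- The closed form and its differential equation

denominator : Ser
denominator = (Z.1# Z.+ yS) Z.* sinhW - sqrtY Z.* coshW

denominator′ : Ser
denominator′ = (constS 1ℚ +ₛ yS) *ₛ sinhW -ₛ sqrtY *ₛ coshW

denominator≋ : denominator′ PZ.≋ denominator
denominator≋ = Z.+-cong
  (Z.trans (*ₛ≋⊛ (constS 1ℚ +ₛ yS) sinhW) (Z.*-congʳ {sinhW} (Z.+-congʳ {yS} (constS≋ 1ℚ))))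
  (Z.-‿cong (*ₛ≋⊛ sqrtY coshW))

V : Ser
V = invS denominator′

V-inverse : V Z.* denominator Z.≈ Z.1#
-- The constant term of the denominator evaluates to -1, so its vanishing is refuted by computation.
V-inverse = Z.trans (Z.*-congˡ {V} (Z.sym denominator≋)) (invS-inverseˡ denominator′ λ ())

rhs≋F : rhs Z.≈ (⟦ - (ℤ.+ 2 / 1) ⟧ Z.* sinhW Z.* V)
rhs≋F = Z.trans (*ₛ≋⊛ (scaleS (- (ℤ.+ 2 / 1)) sinhW) V) (Z.*-congʳ {V} (scaleS≋ (- (ℤ.+ 2 / 1)) sinhW))

∂rhs : PZ.∂ rhs Z.≈ (sqrtY Z.* sqrtY) Z.* (V Z.* V)
∂rhs = Z.trans (PZ.∂-cong rhs≋F) (DF {sqrtY} {sinhW} {coshW} ∂-sinhW ∂-coshW {yS} {V} ∂-yS ∂-sqrtY sqrtY² cosh²≋1+sinh² V-inverse)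

∂∂rhs : PZ.∂ (PZ.∂ rhs) Z.≈ PZ.∂ rhs Z.* (yS Z.+ (Z.1# Z.+ yS Z.* rhs))
∂∂rhs = Z.trans (PZ.∂-cong (PZ.∂-cong rhs≋F)) (Z.trans
  (DDF {sqrtY} {sinhW} {coshW} ∂-sinhW ∂-coshW {yS} {V} ∂-yS ∂-sqrtY sqrtY² cosh²≋1+sinh² V-inverse)
  (Z.*-cong (PZ.∂-cong (Z.sym rhs≋F)) (Z.+-congˡ {yS} (Z.+-congˡ {Z.1#} (Z.*-congˡ {yS} (Z.sym rhs≋F))))))

rhs-0 : rhs 0 Y.≈ Y.0#
rhs-0 = begin
  rhs 0                                              ≈⟨ rhs≋F 0 ⟩
  PY.const (- (ℤ.+ 2 / 1)) Y.* sinhW 0 Y.* V 0       ≈⟨ Y.*-congʳ {V 0} (Y.*-congˡ {PY.const (- (ℤ.+ 2 / 1))} sinhW-0) ⟩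
  PY.const (- (ℤ.+ 2 / 1)) Y.* Y.0# Y.* V 0          ≈⟨ Y.*-congʳ {V 0} (Y.zeroʳ (PY.const (- (ℤ.+ 2 / 1)))) ⟩
  Y.0# Y.* V 0                                       ≈⟨ Y.zeroˡ (V 0) ⟩
  Y.0#                                               ∎
  where open SetoidReasoning Y.setoid

denominator-0 : denominator 0 Y.≈ Y.- √
denominator-0 = begin
  ((Z.1# Z.+ yS) 0 Y.* sinhW 0) Y.- √ Y.* coshW 0    ≈⟨ Y.+-cong (Y.*-congˡ {(Z.1# Z.+ yS) 0} sinhW-0) (Y.-‿cong (Y.*-congˡ {√} coshW-0)) ⟩
  ((Z.1# Z.+ yS) 0 Y.* Y.0#) Y.- √ Y.* Y.1#          ≈⟨ Y.+-cong (Y.zeroʳ ((Z.1# Z.+ yS) 0)) (Y.-‿cong (Y.*-identityʳ √)) ⟩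
  Y.0# Y.- √                                         ≈⟨ Y.+-identityˡ (Y.- √) ⟩
  Y.- √                                              ∎
  where open SetoidReasoning Y.setoid

-- At z = 0 the denominator is -√, so V(0) inverts -√; the product √² V(0)² is the square of -√ V(0)
-- = 1.
∂rhs-0 : PZ.∂ rhs 0 Y.≈ Y.1#
∂rhs-0 = begin
  PZ.∂ rhs 0                        ≈⟨ ∂rhs 0 ⟩
  √ Y.* √ Y.* (V 0 Y.* V 0)         ≈⟨ Y.*-congʳ {V 0 Y.* V 0} (-x*-x √) ⟨
  Y.- √ Y.* Y.- √ Y.* (V 0 Y.* V 0) ≈⟨ interchange (Y.- √) (Y.- √) (V 0) (V 0) ⟩
  Y.- √ Y.* V 0 Y.* (Y.- √ Y.* V 0) ≈⟨ Y.*-cong -√*V₀ -√*V₀ ⟩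
  Y.1# Y.* Y.1#                     ≈⟨ Y.*-identityˡ Y.1# ⟩
  Y.1#                              ∎
  where
  open SetoidReasoning Y.setoid
  open CommutativeSemigroupProperties Y.*-commutativeSemigroup using (interchange)
  open RingProperties Y.ring using (-‿distribˡ-*; -‿distribʳ-*; -‿involutive)
  -x*-x : ∀ x → Y.- x Y.* Y.- x Y.≈ x Y.* x
  -x*-x x = Y.trans (Y.sym (-‿distribˡ-* x (Y.- x))) (Y.trans (Y.-‿cong (Y.sym (-‿distribʳ-* x x))) (-‿involutive (x Y.* x)))
  -√*V₀ : Y.- √ Y.* V 0 Y.≈ Y.1#
  -√*V₀ = Y.trans (Y.*-comm (Y.- √) (V 0)) (Y.trans (Y.*-congˡ {V 0} (Y.sym denominator-0)) (V-inverse 0))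

-- Growing t-shelves leaf by leaf

leaf : ℕ → BTree
leaf x = node nil x nil

-- Grow x s t: t arises from s by attaching a leaf x without creating a pattern P, provided x
-- exceeds all labels of s. A right leaf is attached only to a childless node.
data Grow (x : ℕ) : BTree → BTree → Set where
  left  : ∀ {a r} → Grow x (node nil a r) (node (leaf x) a r)
  right : ∀ {a} → Grow x (node nil a nil) (node nil a (leaf x))
  inˡ   : ∀ {l l′ a r} → Grow x l l′ → Grow x (node l a r) (node l′ a r)
  inʳ   : ∀ {l a r r′} → Grow x r r′ → Grow x (node l a r) (node l a r′)

Increasing : BTree → Set
Increasing nil          = ⊤
Increasing (node l a r) = All (a ℕ.<_) (labels l ++ labels r) × Increasing l × Increasing r

Avoiding : BTree → Set
Avoiding nil          = ⊤
Avoiding (node l a r) = badNode l r ≡ false × Avoiding l × Avoiding r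

grow-labels : ∀ {x s t} → Grow x s t → labels t ↭ x ∷ labels s
grow-labels {x} (left {a} {r})            = ↭.swap a x ↭.refl
grow-labels {x} (right {a})               = ↭.swap a x ↭.refl
grow-labels {x} (inˡ {l} {l′} {a} {r} g)  = ↭.trans (↭.prep a (++⁺ʳ (labels r) (grow-labels g))) (↭.swap a x ↭.refl)
grow-labels {x} (inʳ {l} {a} {r} {r′} g)  = ↭.trans
  (↭.prep a (↭.trans (++⁺ˡ (labels l) (grow-labels g)) (shift x (labels l) (labels r)))) (↭.swap a x ↭.refl)

-- Growth keeps the root, and `badNode` inspects only root labels.
grow-badNodeˡ : ∀ {x l l′} r → Grow x l l′ → badNode l′ r ≡ badNode l r
grow-badNodeˡ nil          left    = refl
grow-badNodeˡ nil          right   = refl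
grow-badNodeˡ nil          (inˡ _) = refl
grow-badNodeˡ nil          (inʳ _) = refl
grow-badNodeˡ (node _ _ _) left    = refl
grow-badNodeˡ (node _ _ _) right   = refl
grow-badNodeˡ (node _ _ _) (inˡ _) = refl
grow-badNodeˡ (node _ _ _) (inʳ _) = refl

grow-badNodeʳ : ∀ {x r r′} l → Grow x r r′ → badNode l r′ ≡ badNode l r
grow-badNodeʳ nil          _       = refl
grow-badNodeʳ (node _ _ _) left    = refl
grow-badNodeʳ (node _ _ _) right   = refl
grow-badNodeʳ (node _ _ _) (inˡ _) = refl
grow-badNodeʳ (node _ _ _) (inʳ _) = refl

grow-increasing : ∀ {x s t} → Grow x s t → All (ℕ._< x) (labels s) → Increasing s → Increasing t
grow-increasing left (a<x ∷ _) (a< , _ , incr) = a<x ∷ a< , ([] , tt , tt) , incr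
grow-increasing right (a<x ∷ _) _ = a<x ∷ [] , tt , [] , tt , tt
grow-increasing (inˡ {l} {l′} {a} {r} g) (a<x ∷ <x) (a< , incl , incr) =
  All.++⁺ (All-resp-↭ (↭-sym (grow-labels g)) (a<x ∷ All.++⁻ˡ (labels l) a<)) (All.++⁻ʳ (labels l) a<) ,
  grow-increasing g (All.++⁻ˡ (labels l) <x) incl , incr
grow-increasing (inʳ {l} g) (a<x ∷ <x) (a< , incl , incr) =
  All.++⁺ (All.++⁻ˡ (labels l) a<) (All-resp-↭ (↭-sym (grow-labels g)) (a<x ∷ All.++⁻ʳ (labels l) a<)) ,
  incl , grow-increasing g (All.++⁻ʳ (labels l) <x) incr

grow-increasing⁻ : ∀ {x s t} → Grow x s t → Increasing t → Increasing s
grow-increasing⁻ left (_ ∷ a< , _ , incr) = a< , tt , incr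
grow-increasing⁻ right _ = [] , tt , tt
grow-increasing⁻ (inˡ {l} {l′} g) (a< , incl , incr) =
  All.++⁺ (All.tail (All-resp-↭ (grow-labels g) (All.++⁻ˡ (labels l′) a<))) (All.++⁻ʳ (labels l′) a<) ,
  grow-increasing⁻ g incl , incr
grow-increasing⁻ (inʳ {l} g) (a< , incl , incr) =
  All.++⁺ (All.++⁻ˡ (labels l) a<) (All.tail (All-resp-↭ (grow-labels g) (All.++⁻ʳ (labels l) a<))) ,
  incl , grow-increasing⁻ g incr

≮⇒<ᵇ≡false : ∀ {m n} → ¬ m ℕ.< n → (m ℕ.<ᵇ n) ≡ false
≮⇒<ᵇ≡false {m} {n} m≮n with m ℕ.<ᵇ n in eq
... | false = refl
... | true  = contradiction (ℕ.<ᵇ⇒< m n (subst T (sym eq) tt)) m≮n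

<⇒<ᵇ≡true : ∀ {m n} → m ℕ.< n → (m ℕ.<ᵇ n) ≡ true
<⇒<ᵇ≡true m<n = to Bool.T-≡ (ℕ.<⇒<ᵇ m<n)

-- The only new pair of siblings arises in `left` next to a right child c; there c < x rules out the
-- pattern.
grow-avoiding : ∀ {x s t} → Grow x s t → All (ℕ._< x) (labels s) → Avoiding s → Avoiding t
grow-avoiding (left {r = nil}) _ (_ , _ , avr) = refl , (refl , tt , tt) , avr
grow-avoiding (left {r = node _ _ _}) (_ ∷ c<x ∷ _) (_ , _ , avr) =
  ≮⇒<ᵇ≡false (ℕ.<⇒≯ c<x) , (refl , tt , tt) , avr
grow-avoiding right _ _ = refl , tt , refl , tt , tt
grow-avoiding (inˡ {l} {r = r} g) (_ ∷ <x) (good , avl , avr) =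
  trans (grow-badNodeˡ r g) good , grow-avoiding g (All.++⁻ˡ (labels l) <x) avl , avr
grow-avoiding (inʳ {l} g) (_ ∷ <x) (good , avl , avr) =
  trans (grow-badNodeʳ l g) good , avl , grow-avoiding g (All.++⁻ʳ (labels l) <x) avr

grow-avoiding⁻ : ∀ {x s t} → Grow x s t → Avoiding t → Avoiding s
grow-avoiding⁻ left (_ , _ , avr) = refl , tt , avr
grow-avoiding⁻ right _ = refl , tt , tt
grow-avoiding⁻ (inˡ {r = r} g) (good , avl , avr) = trans (sym (grow-badNodeˡ r g)) good , grow-avoiding⁻ g avl , avr
grow-avoiding⁻ (inʳ {l} g) (good , avl , avr) = trans (sym (grow-badNodeʳ l g)) good , avl , grow-avoiding⁻ g avr

grow-∈ : ∀ {x s t} → Grow x s t → x ∈ labels t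
grow-∈ g = ∈-resp-↭ (↭-sym (grow-labels g)) (here refl)

grow-irreflexive : ∀ {x t} → ¬ Grow x t t
grow-irreflexive g = ℕ.1+n≢n (sym (↭-length (grow-labels g)))

-- The position of x in t determines the parent tree: if the two growths added different nodes, the
-- node added by one would already carry x in the other's source.
grow-injective : ∀ {x s s′ t} → x ∉ labels s → x ∉ labels s′ → Grow x s t → Grow x s′ t → s ≡ s′
grow-injective x∉ x∉′ left left = refl
grow-injective x∉ x∉′ right right = refl
grow-injective x∉ x∉′ left (inˡ (inˡ ()))
grow-injective x∉ x∉′ left (inˡ (inʳ ()))
grow-injective x∉ x∉′ left (inʳ g′) = contradiction (there (here refl)) x∉′
grow-injective x∉ x∉′ right (inʳ (inˡ ()))
grow-injective x∉ x∉′ right (inʳ (inʳ ()))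
grow-injective x∉ x∉′ (inˡ (inˡ ())) left
grow-injective x∉ x∉′ (inˡ (inʳ ())) left
grow-injective x∉ x∉′ (inˡ {l} {a = a} {r} g) (inˡ {l₂} g′) =
  cong (λ l → node l a r) (grow-injective (x∉ ∘ there ∘ ∈-++⁺ˡ) (x∉′ ∘ there ∘ ∈-++⁺ˡ) g g′)
grow-injective x∉ x∉′ (inˡ g) (inʳ g′) = contradiction (there (∈-++⁺ˡ (grow-∈ g))) x∉′
grow-injective x∉ x∉′ (inʳ g) left = contradiction (there (here refl)) x∉
grow-injective x∉ x∉′ (inʳ (inˡ ())) right
grow-injective x∉ x∉′ (inʳ (inʳ ())) right
grow-injective x∉ x∉′ (inʳ {l} g) (inˡ g′) = contradiction (there (∈-++⁺ˡ (grow-∈ g′))) x∉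
grow-injective x∉ x∉′ (inʳ {l} {a} g) (inʳ g′) =
  cong (node l a) (grow-injective (x∉ ∘ there ∘ ∈-++⁺ʳ (labels l)) (x∉′ ∘ there ∘ ∈-++⁺ʳ (labels l)) g g′)

-- Multiplicities of labels

countOcc-≡ : ∀ x xs → countOcc x (x ∷ xs) ≡ suc (countOcc x xs)
countOcc-≡ x xs with x ℕ.≡ᵇ x in eq
... | true  = refl
... | false = contradiction (ℕ.≡⇒≡ᵇ x x refl) (subst (¬_ ∘ T) (sym eq) λ ())

countOcc-≢ : ∀ {i x} xs → i ≢ x → countOcc i (x ∷ xs) ≡ countOcc i xs
countOcc-≢ {i} {x} xs i≢x with i ℕ.≡ᵇ x in eq
... | false = refl
... | true  = contradiction (ℕ.≡ᵇ⇒≡ i x (subst T (sym eq) tt)) i≢x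

countOcc-∷ : ∀ i x {xs ys} → countOcc i xs ≡ countOcc i ys → countOcc i (x ∷ xs) ≡ countOcc i (x ∷ ys)
countOcc-∷ i x eq with i ℕ.≡ᵇ x
... | true  = cong suc eq
... | false = eq

countOcc-++ : ∀ i xs ys → countOcc i (xs ++ ys) ≡ countOcc i xs ℕ.+ countOcc i ys
countOcc-++ i []       ys = refl
countOcc-++ i (x ∷ xs) ys with i ℕ.≡ᵇ x
... | true  = cong suc (countOcc-++ i xs ys)
... | false = countOcc-++ i xs ys

countOcc-↭ : ∀ i {xs ys} → xs ↭ ys → countOcc i xs ≡ countOcc i ys
countOcc-↭ i ↭.refl        = refl
countOcc-↭ i (↭.prep x p)  = countOcc-∷ i x (countOcc-↭ i p)
countOcc-↭ i (↭.swap {xs} {ys} x y p) with i ℕ.≡ᵇ x in eq₁ | i ℕ.≡ᵇ y in eq₂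
... | true  | true  rewrite eq₁ | eq₂ = cong (λ c → suc (suc c)) (countOcc-↭ i p)
... | true  | false rewrite eq₁ | eq₂ = cong suc (countOcc-↭ i p)
... | false | true  rewrite eq₁ | eq₂ = cong suc (countOcc-↭ i p)
... | false | false rewrite eq₁ | eq₂ = countOcc-↭ i p
countOcc-↭ i (↭.trans p q) = trans (countOcc-↭ i p) (countOcc-↭ i q)

countOcc⇒∈ : ∀ i xs {n} → countOcc i xs ≡ suc n → i ∈ xs
countOcc⇒∈ i (x ∷ xs) eq with i ℕ.≟ x
... | yes refl = here refl
... | no  i≢x    = there (countOcc⇒∈ i xs (trans (sym (countOcc-≢ xs i≢x)) eq))

∉⇒countOcc : ∀ {i} xs → i ∉ xs → countOcc i xs ≡ 0
∉⇒countOcc []       _ = refl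
∉⇒countOcc (x ∷ xs) i∉ = trans (countOcc-≢ xs (i∉ ∘ here)) (∉⇒countOcc xs (i∉ ∘ there))

countOcc≡0⇒≢ : ∀ {i x xs} → countOcc i (x ∷ xs) ≡ 0 → i ≢ x
countOcc≡0⇒≢ {i} {xs = xs} eq refl = ℕ.1+n≢0 (trans (sym (countOcc-≡ i xs)) eq)

EachOnce : ℕ → List ℕ → Set
EachOnce n xs = ∀ i → 1 ℕ.≤ i → i ℕ.≤ n → countOcc i xs ≡ 1

-- A pigeonhole argument: each of 1, ..., n uses up one of the n entries, so no larger label fits.
-- The induction removes the entry n.
eachOnce⇒≤ : ∀ n xs → length xs ≡ n → EachOnce n xs → All (ℕ._≤ n) xs
eachOnce⇒≤ zero    []  _  _    = []
eachOnce⇒≤ (suc n) xs  eq once with ∈-∃++ (countOcc⇒∈ (suc n) xs (once (suc n) (s≤s z≤n) ℕ.≤-refl))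
... | ys , zs , refl = All-resp-↭ (↭-sym perm) (ℕ.≤-refl ∷ All.map ℕ.m≤n⇒m≤1+n
        (eachOnce⇒≤ n (ys ++ zs) (ℕ.suc-injective (trans (sym (↭-length perm)) eq)) once′))
  where
  perm = shift (suc n) ys zs
  once′ : EachOnce n (ys ++ zs)
  once′ i 1≤i i≤n = trans (sym (countOcc-≢ (ys ++ zs) (ℕ.<⇒≢ (s≤s i≤n))))
    (trans (sym (countOcc-↭ i perm)) (once i 1≤i (ℕ.m≤n⇒m≤1+n i≤n)))

-- Removing the largest label

no-labels : ∀ t → labels t ≡ [] → t ≡ nil
no-labels nil _ = refl

root-maximal : ∀ {a} xs → All (a ℕ.<_) xs → All (ℕ._≤ a) xs → xs ≡ []
root-maximal []       _          _          = refl
root-maximal (x ∷ xs) (a<x ∷ _) (x≤a ∷ _) = contradiction x≤a (ℕ.<⇒≱ a<x)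

maximal-leaf : ∀ l x r → Increasing (node l x r) → All (ℕ._≤ x) (labels l ++ labels r) → node l x r ≡ leaf x
maximal-leaf l x r (x< , _) ≤x = cong₂ (λ l r → node l x r)
  (no-labels l (List.++-conicalˡ (labels l) (labels r) empty))
  (no-labels r (List.++-conicalʳ (labels l) (labels r) empty))
  where
  empty = root-maximal _ x< ≤x

-- Descend towards the single occurrence of the maximum x, the multiplicities telling which subtree
-- holds it. Once x is the root of a child subtree, `maximal-leaf` shows that child to be a leaf,
-- which is then removed.
ungrow : ∀ {x} l a r → x ≢ a → countOcc x (labels (node l a r)) ≡ 1 → All (ℕ._≤ x) (labels (node l a r)) →
  Increasing (node l a r) → Avoiding (node l a r) → ∃ λ s → Grow x s (node l a r)
ungrow {x} l a r x≢a once (_ ∷ ≤x) (_ , incl , incr) (good , avl , avr) = split (countOcc x (labels l)) refl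
  where
  ≤xˡ = All.++⁻ˡ (labels l) ≤x
  ≤xʳ = All.++⁻ʳ (labels l) ≤x

  once′ : countOcc x (labels l) ℕ.+ countOcc x (labels r) ≡ 1
  once′ = trans (sym (trans (countOcc-≢ _ x≢a) (countOcc-++ x (labels l) (labels r)))) once

  inLeft : ∀ l → countOcc x (labels l) ≡ 1 → All (ℕ._≤ x) (labels l) → Increasing l → Avoiding l →
    ∃ λ s → Grow x s (node l a r)
  inLeft (node l₁ b l₂) once ≤x@(_ ∷ ≤x₁₂) inc av with x ℕ.≟ b
  ... | yes refl rewrite maximal-leaf l₁ x l₂ inc ≤x₁₂ = _ , left
  ... | no  x≢b    = let s , g = ungrow l₁ b l₂ x≢b once ≤x inc av in _ , inˡ g

  inRight : ∀ l r → badNode l r ≡ false → countOcc x (labels l) ≡ 0 → All (ℕ._≤ x) (labels l) →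
    countOcc x (labels r) ≡ 1 → All (ℕ._≤ x) (labels r) → Increasing r → Avoiding r → ∃ λ s → Grow x s (node l a r)
  inRight l (node r₁ c r₂) good none ≤xˡ once ≤x@(_ ∷ ≤x₁₂) inc av with x ℕ.≟ c
  ... | no  x≢c    = let s , g = ungrow r₁ c r₂ x≢c once ≤x inc av in _ , inʳ g
  inRight nil (node r₁ c r₂) good none ≤xˡ once (_ ∷ ≤x₁₂) inc av | yes refl
    rewrite maximal-leaf r₁ x r₂ inc ≤x₁₂ = _ , right
  -- Here x is a right child with left sibling b. As x does not occur on the left, b ≤ x is strict
  -- and the pattern P appears; hence `Grow` needs no right leaf beside a left child.
  inRight (node _ b _) (node r₁ c r₂) good none (b≤x ∷ _) once (_ ∷ ≤x₁₂) inc av | yes refl =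
    contradiction (trans (sym (<⇒<ᵇ≡true (ℕ.≤∧≢⇒< b≤x (countOcc≡0⇒≢ none ∘ sym)))) good) λ ()

  split : ∀ n → countOcc x (labels l) ≡ n → ∃ λ s → Grow x s (node l a r)
  split zero          eq = inRight l r good eq ≤xˡ (trans (cong (ℕ._+ countOcc x (labels r)) (sym eq)) once′) ≤xʳ incr avr
  split (suc zero)    eq = inLeft l eq ≤xˡ incl avl
  split (suc (suc n)) eq = contradiction (trans (cong (ℕ._+ countOcc x (labels r)) (sym eq)) once′) λ ()

-- Listing the growths and the shelves

growths : ℕ → BTree → List BTree
growths x nil = []
growths x (node nil a nil) = node (leaf x) a nil ∷ node nil a (leaf x) ∷ []
growths x (node nil a r@(node _ _ _)) = node (leaf x) a r ∷ map (node nil a) (growths x r)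
growths x (node l@(node _ _ _) a nil) = map (λ l′ → node l′ a nil) (growths x l)
growths x (node l@(node _ _ _) a r@(node _ _ _)) =
  map (λ l′ → node l′ a r) (growths x l) ++ map (node l a) (growths x r)

∈-growths⁻ : ∀ {x t} s → t ∈ growths x s → Grow x s t
∈-growths⁻ (node nil a nil) (here refl) = left
∈-growths⁻ (node nil a nil) (there (here refl)) = right
∈-growths⁻ (node nil a (node _ _ _)) (here refl) = left
∈-growths⁻ (node nil a r@(node _ _ _)) (there t∈) with ∈-map⁻ (node nil a) t∈
... | _ , r′∈ , refl = inʳ (∈-growths⁻ r r′∈)
∈-growths⁻ (node l@(node _ _ _) a nil) t∈ with ∈-map⁻ (λ l′ → node l′ a nil) t∈
... | _ , l′∈ , refl = inˡ (∈-growths⁻ l l′∈)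
∈-growths⁻ {x} (node l@(node _ _ _) a r@(node _ _ _)) t∈ with ∈-++⁻ (map (λ l′ → node l′ a r) (growths x l)) t∈
... | inj₁ t∈ˡ with ∈-map⁻ (λ l′ → node l′ a r) t∈ˡ
...   | _ , l′∈ , refl = inˡ (∈-growths⁻ l l′∈)
∈-growths⁻ {x} (node l@(node _ _ _) a r@(node _ _ _)) t∈ | inj₂ t∈ʳ with ∈-map⁻ (node l a) t∈ʳ
...   | _ , r′∈ , refl = inʳ (∈-growths⁻ r r′∈)

∈-growths⁺ : ∀ {x s t} → Grow x s t → t ∈ growths x s
∈-growths⁺ (left {r = nil})        = here refl
∈-growths⁺ (left {r = node _ _ _}) = here refl
∈-growths⁺ right                   = there (here refl)
∈-growths⁺ (inˡ {node _ _ _} {r = nil} g)        = ∈-map⁺ _ (∈-growths⁺ g)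
∈-growths⁺ (inˡ {node _ _ _} {r = node _ _ _} g) = ∈-++⁺ˡ (∈-map⁺ _ (∈-growths⁺ g))
∈-growths⁺ (inʳ {nil} {r = node _ _ _} g)        = there (∈-map⁺ _ (∈-growths⁺ g))
∈-growths⁺ {x} (inʳ {l@(node _ _ _)} {a} {r = r@(node _ _ _)} g) =
  ∈-++⁺ʳ (map (λ l′ → node l′ a r) (growths x l)) (∈-map⁺ _ (∈-growths⁺ g))

node-injectiveˡ : ∀ {l l′ a a′ r r′} → node l a r ≡ node l′ a′ r′ → l ≡ l′
node-injectiveˡ refl = refl

node-injectiveʳ : ∀ {l l′ a a′ r r′} → node l a r ≡ node l′ a′ r′ → r ≡ r′
node-injectiveʳ refl = refl

-- A tree in both mapped lists would have an unchanged left subtree that is also a growth of itself,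
-- against `grow-irreflexive`.
growths-unique : ∀ x t → Unique (growths x t)
growths-unique x nil = []
growths-unique x (node nil a nil) = ((λ ()) ∷ []) ∷ [] ∷ []
growths-unique x (node nil a r@(node _ _ _)) =
  All.map⁺ (All.universal (λ _ ()) (growths x r)) ∷ Unique.map⁺ node-injectiveʳ (growths-unique x r)
growths-unique x (node l@(node _ _ _) a nil) = Unique.map⁺ node-injectiveˡ (growths-unique x l)
growths-unique x (node l@(node _ _ _) a r@(node _ _ _)) = Unique.++⁺
  (Unique.map⁺ node-injectiveˡ (growths-unique x l)) (Unique.map⁺ node-injectiveʳ (growths-unique x r)) disjoint
  where
  disjoint : Disjoint (map (λ l′ → node l′ a r) (growths x l)) (map (node l a) (growths x r))
  disjoint (t∈ˡ , t∈ʳ) with ∈-map⁻ (λ l′ → node l′ a r) t∈ˡ | ∈-map⁻ (node l a) t∈ʳ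
  ... | _ , l∈ , refl | _ , _ , refl = grow-irreflexive (∈-growths⁻ l l∈)

-- Besides uniqueness within each block, distinct parents must share no child; for growths this is
-- `grow-injective`.
concatMap-unique : ∀ {A B : Set} (f : A → List B) {xs} → Unique xs → (∀ x → Unique (f x)) →
  (∀ {x y z} → x ∈ xs → y ∈ xs → z ∈ f x → z ∈ f y → x ≡ y) → Unique (concatMap f xs)
concatMap-unique f []            f! inj = []
concatMap-unique f {x ∷ xs} (x∉ ∷ xs!) f! inj = Unique.++⁺ (f! x)
  (concatMap-unique f xs! f! λ y∈ z∈ → inj (there y∈) (there z∈))
  λ (z∈fx , z∈rest) → let y , y∈ , z∈fy = find (∈-concatMap⁻ f z∈rest) in
    All.lookup x∉ y∈ (inj (here refl) (there y∈) z∈fx z∈fy)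

-- The index is one less than the size, since the smallest shelf is the single node 1; the leaf
-- added to a shelf of size n + 1 carries n + 2.
shelves : ℕ → List BTree
shelves zero    = leaf 1 ∷ []
shelves (suc n) = concatMap (growths (2 ℕ.+ n)) (shelves n)

IsShelf : ℕ → BTree → Set
IsShelf n t = size t ≡ n × EachOnce n (labels t) × Increasing t × Avoiding t

isShelf⇒≤ : ∀ {n t} → IsShelf n t → All (ℕ._≤ n) (labels t)
isShelf⇒≤ {n} {t} (size≡n , once , _) = eachOnce⇒≤ n (labels t) size≡n once

isShelf⇒∉ : ∀ {n t} → IsShelf n t → suc n ∉ labels t
isShelf⇒∉ shelf n∈ = ℕ.1+n≰n (All.lookup (isShelf⇒≤ shelf) n∈)

shelves-sound : ∀ n {t} → t ∈ shelves n → IsShelf (suc n) t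
shelves-sound zero (here refl) = refl , once , ([] , tt , tt) , refl , tt , tt
  where
  once : EachOnce 1 (1 ∷ [])
  once 1 _ _ = refl
  once (suc (suc i)) _ (s≤s ())
shelves-sound (suc n) {t} t∈ with find (∈-concatMap⁻ (growths (2 ℕ.+ n)) t∈)
... | s , s∈ , t∈s = trans (↭-length perm) (cong suc size≡) , once′ ,
        grow-increasing g <n inc , grow-avoiding g <n av
  where
  g = ∈-growths⁻ s t∈s
  perm = grow-labels g
  shelf = shelves-sound n s∈
  size≡ = proj₁ shelf
  once = proj₁ (proj₂ shelf)
  inc = proj₁ (proj₂ (proj₂ shelf))
  av = proj₂ (proj₂ (proj₂ shelf))
  <n : All (ℕ._< 2 ℕ.+ n) (labels s)
  <n = All.map s≤s (isShelf⇒≤ {t = s} shelf)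
  once′ : EachOnce (2 ℕ.+ n) (labels t)
  once′ i 1≤i i≤ with i ℕ.≟ 2 ℕ.+ n
  ... | yes refl = trans (countOcc-↭ (2 ℕ.+ n) perm) (trans (countOcc-≡ (2 ℕ.+ n) (labels s))
                      (cong suc (∉⇒countOcc (labels s) (isShelf⇒∉ {t = s} shelf))))
  ... | no  i≢     = trans (countOcc-↭ i perm) (trans (countOcc-≢ (labels s) i≢)
                      (once i 1≤i (ℕ.≤-pred (ℕ.≤∧≢⇒< i≤ i≢))))

shelves-complete : ∀ n t → IsShelf (suc n) t → t ∈ shelves n
shelves-complete zero (node l a r) (size≡ , once , _) with countOcc⇒∈ 1 (a ∷ labels l ++ labels r) (once 1 ℕ.≤-refl ℕ.≤-refl)
... | 1∈ with labels l ++ labels r in eq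
... | [] with 1∈
... | here refl = here (cong₂ (λ l r → node l 1 r)
  (no-labels l (List.++-conicalˡ (labels l) (labels r) eq)) (no-labels r (List.++-conicalʳ (labels l) (labels r) eq)))
shelves-complete (suc n) t@(node l a r) shelf@(size≡ , once , inc , av) =
  ∈-concatMap⁺ (growths (2 ℕ.+ n)) (lose (shelves-complete n s shelf′) (∈-growths⁺ g))
  where
  ≤n = isShelf⇒≤ {t = t} shelf
  root≢ : 2 ℕ.+ n ≢ a
  -- A root carrying the largest label would be a leaf, and the tree would have size 1.
  root≢ refl = contradiction (trans (cong length (sym (cong labels (maximal-leaf l a r inc (All.tail ≤n))))) size≡) λ ()
  s = proj₁ (ungrow l a r root≢ (once (2 ℕ.+ n) (s≤s z≤n) ℕ.≤-refl) ≤n inc av)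
  g = proj₂ (ungrow l a r root≢ (once (2 ℕ.+ n) (s≤s z≤n) ℕ.≤-refl) ≤n inc av)
  shelf′ : IsShelf (suc n) s
  shelf′ = ℕ.suc-injective (trans (sym (↭-length (grow-labels g))) size≡) ,
    (λ i 1≤i i≤ → trans (sym (countOcc-≢ (labels s) (ℕ.<⇒≢ (s≤s i≤))))
      (trans (sym (countOcc-↭ i (grow-labels g))) (once i 1≤i (ℕ.m≤n⇒m≤1+n i≤)))) ,
    grow-increasing⁻ g inc , grow-avoiding⁻ g av

shelves-unique : ∀ n → Unique (shelves n)
shelves-unique zero    = [] ∷ []
shelves-unique (suc n) = concatMap-unique (growths (2 ℕ.+ n)) (shelves-unique n) (growths-unique (2 ℕ.+ n))
  λ {s} {s′} s∈ s′∈ t∈ t∈′ → grow-injective (isShelf⇒∉ {t = s} (shelves-sound n s∈)) (isShelf⇒∉ {t = s′} (shelves-sound n s′∈))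
    (∈-growths⁻ s t∈) (∈-growths⁻ s′ t∈′)

-- The Boolean predicates of the statement and the cardinality of `G`

allB⇔All : ∀ {p : ℕ → Bool} {P : ℕ → Set} → (∀ x → T (p x) ⇔ P x) → ∀ xs → T (allB p xs) ⇔ All P xs
allB⇔All p⇔P []       = mk⇔ (λ _ → []) (λ _ → tt)
allB⇔All p⇔P (x ∷ xs) = mk⇔
  (λ h → let px , pxs = to Bool.T-∧ h in to (p⇔P x) px ∷ to (allB⇔All p⇔P xs) pxs)
  (λ { (px ∷ pxs) → from Bool.T-∧ (from (p⇔P x) px , from (allB⇔All p⇔P xs) pxs) })

increasing⇔ : ∀ t → T (increasing t) ⇔ Increasing t
increasing⇔ nil = mk⇔ (λ _ → tt) (λ _ → tt)
increasing⇔ (node l a r) = mk⇔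
  (λ h → let h₁ , h₂ = to Bool.T-∧ h ; hl , hr = to Bool.T-∧ h₂ in
    to a<⇔ h₁ , to (increasing⇔ l) hl , to (increasing⇔ r) hr)
  (λ (a< , il , ir) → from Bool.T-∧ (from a<⇔ a< , from Bool.T-∧ (from (increasing⇔ l) il , from (increasing⇔ r) ir)))
  where
  a<⇔ = allB⇔All (λ b → mk⇔ (ℕ.<ᵇ⇒< a b) ℕ.<⇒<ᵇ) (labels l ++ labels r)

avoidsP⇔ : ∀ t → T (avoidsP t) ⇔ Avoiding t
avoidsP⇔ nil = mk⇔ (λ _ → tt) (λ _ → tt)
avoidsP⇔ (node l a r) = mk⇔
  (λ h → let h₁ , h₂ = to Bool.T-∧ h ; hl , hr = to Bool.T-∧ h₂ in
    to Bool.T-not-≡ h₁ , to (avoidsP⇔ l) hl , to (avoidsP⇔ r) hr)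
  (λ (good , al , ar) → from Bool.T-∧ (from Bool.T-not-≡ good , from Bool.T-∧ (from (avoidsP⇔ l) al , from (avoidsP⇔ r) ar)))

occursOnce⇔ : ∀ n xs i → T (occursOnce n xs i) ⇔ EachOnce i xs
occursOnce⇔ n xs zero    = mk⇔ (λ { _ .0 () z≤n }) (λ _ → tt)
occursOnce⇔ n xs (suc i) = mk⇔ forward
  (λ once → from Bool.T-∧ (ℕ.≡⇒≡ᵇ _ 1 (once (suc i) (s≤s z≤n) ℕ.≤-refl) ,
    from (occursOnce⇔ n xs i) (λ j 1≤j j≤i → once j 1≤j (ℕ.m≤n⇒m≤1+n j≤i))))
  where
  forward : T (occursOnce n xs (suc i)) → EachOnce (suc i) xs
  forward h j 1≤j j≤ with j ℕ.≟ suc i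
  ... | yes refl = ℕ.≡ᵇ⇒≡ _ 1 (proj₁ (to Bool.T-∧ h))
  ... | no  j≢     = to (occursOnce⇔ n xs i) (proj₂ (to Bool.T-∧ h)) j 1≤j (ℕ.≤-pred (ℕ.≤∧≢⇒< j≤ j≢))

G⇔ : ∀ n k t → T (isTShelf n t ∧ avoidsP t ∧ (leftChildren t ℕ.≡ᵇ k)) ⇔ (IsShelf n t × leftChildren t ≡ k)
G⇔ n k t = mk⇔
  (λ h → let h₁ , h₂ = to Bool.T-∧ h ; av , lc = to Bool.T-∧ h₂ ; lab , inc = to Bool.T-∧ h₁ ; sz , occ = to Bool.T-∧ lab in
    (ℕ.≡ᵇ⇒≡ _ n sz , to (occursOnce⇔ n (labels t) n) occ , to (increasing⇔ t) inc , to (avoidsP⇔ t) av) , ℕ.≡ᵇ⇒≡ _ k lc)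
  (λ ((sz , occ , inc , av) , lc) → from Bool.T-∧
    ( from Bool.T-∧ (from Bool.T-∧ (ℕ.≡⇒≡ᵇ _ n sz , from (occursOnce⇔ n (labels t) n) occ) , from (increasing⇔ t) inc)
    , from Bool.T-∧ (from (avoidsP⇔ t) av , ℕ.≡⇒≡ᵇ _ k lc)))

lookup-injective : ∀ {A : Set} {xs : List A} → Unique xs → Injective _≡_ _≡_ (lookup xs)
lookup-injective (x∉ ∷ xs!) {zero}  {zero}  _  = refl
lookup-injective (x∉ ∷ xs!) {zero}  {suc j} eq = contradiction eq (All.lookup x∉ (∈-lookup j))
lookup-injective (x∉ ∷ xs!) {suc i} {zero}  eq = contradiction (sym eq) (All.lookup x∉ (∈-lookup i))
lookup-injective (x∉ ∷ xs!) {suc i} {suc j} eq = cong suc (lookup-injective xs! eq)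

shelvesWith : ℕ → ℕ → List BTree
shelvesWith n k = filter (λ t → leftChildren t ℕ.≟ k) (shelves n)

-- An element corresponds to its position in the list. Uniqueness makes `lookup` injective, and
-- proof irrelevance of `T` makes an element of `G` depend on its tree alone.
G↔Fin : ∀ n k → G (suc n) k ↔ Fin (length (shelvesWith n k))
G↔Fin n k = mk↔ₛ′ (index ∘ member) (λ i → lookup L i , valid i)
  (λ i → lookup-injective L! (sym (lookup-index (member (lookup L i , valid i)))))
  (λ g → Σ-≡ (sym (lookup-index (member g))))
  where
  L = shelvesWith n k
  L! : Unique L
  L! = Unique.filter⁺ (λ t → leftChildren t ℕ.≟ k) (shelves-unique n)
  member : (g : G (suc n) k) → proj₁ g ∈ L
  member (t , h) = let shelf , lc = to (G⇔ (suc n) k t) h in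
    ∈-filter⁺ (λ t → leftChildren t ℕ.≟ k) (shelves-complete n t shelf) lc
  valid : ∀ i → T (isTShelf (suc n) (lookup L i) ∧ avoidsP (lookup L i) ∧ (leftChildren (lookup L i) ℕ.≡ᵇ k))
  valid i = let t∈ , lc = ∈-filter⁻ (λ t → leftChildren t ℕ.≟ k) {xs = shelves n} (∈-lookup {xs = L} i) in
    from (G⇔ (suc n) k (lookup L i)) (shelves-sound n t∈ , lc)
  Σ-≡ : ∀ {t t′ : BTree} {h : T (isTShelf (suc n) t ∧ avoidsP t ∧ (leftChildren t ℕ.≡ᵇ k))}
    {h′ : T (isTShelf (suc n) t′ ∧ avoidsP t′ ∧ (leftChildren t′ ℕ.≡ᵇ k))} → t ≡ t′ → (t , h) ≡ (t′ , h′)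
  Σ-≡ {t} refl = cong (t ,_) (Bool.T-irrelevant _ _)

Fin↔G⇒≡ : ∀ {m n k} → Fin m ↔ G (suc n) k → m ≡ length (shelvesWith n k)
Fin↔G⇒≡ {n = n} {k} iso = ↔⇒≡ (G↔Fin n k ↔-∘ iso)

-- Weighted enumeration

U : Ser
U = Z.1# Z.+ yS Z.* rhs

-- The ∂-orbit of the leaf weight ∂ rhs: attaching a leaf to a leaf turns ∂ rhs into
-- ∂ rhs * (y + U), attaching a left leaf to a node with only a right child turns U into y * ∂ rhs.
weight : BTree → Ser
weight nil                                 = Z.1#
weight (node nil _ nil)                    = PZ.∂ rhs
weight (node nil _ r@(node _ _ _))         = U Z.* weight r
weight (node l@(node _ _ _) _ nil)         = yS Z.* weight l
weight (node l@(node _ _ _) _ r@(node _ _ _)) = yS Z.* (weight l Z.* weight r)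

totalWeight : List BTree → Ser
totalWeight []       = Z.0#
totalWeight (t ∷ ts) = weight t Z.+ totalWeight ts

totalWeight-++ : ∀ ts us → totalWeight (ts ++ us) Z.≈ totalWeight ts Z.+ totalWeight us
totalWeight-++ []       us = Z.sym (Z.+-identityˡ (totalWeight us))
totalWeight-++ (t ∷ ts) us = Z.trans (Z.+-congˡ {weight t} (totalWeight-++ ts us))
  (Z.sym (Z.+-assoc (weight t) (totalWeight ts) (totalWeight us)))

-- `weight` distinguishes empty from nonempty children. Growths are never empty, so all growths of
-- one subtree stay in the same clause and share the factor coming from the rest of the tree.
data Nonempty : BTree → Set where
  nonempty : ∀ {l a r} → Nonempty (node l a r)

grow-nonempty : ∀ {x s t} → Grow x s t → Nonempty t
grow-nonempty left    = nonempty
grow-nonempty right   = nonempty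
grow-nonempty (inˡ _) = nonempty
grow-nonempty (inʳ _) = nonempty

totalWeight-map : ∀ f c → (∀ {t} → Nonempty t → weight (f t) Z.≈ c Z.* weight t) →
  ∀ {ts} → All Nonempty ts → totalWeight (map f ts) Z.≈ c Z.* totalWeight ts
totalWeight-map f c eq [] = Z.sym (Z.zeroʳ c)
totalWeight-map f c eq {t ∷ ts} (p ∷ ps) = Z.trans (Z.+-cong (eq p) (totalWeight-map f c eq ps))
  (Z.sym (Z.distribˡ c (weight t) (totalWeight ts)))

∂U : PZ.∂ U Z.≈ yS Z.* PZ.∂ rhs
∂U = begin
  PZ.∂ U                             ≈⟨ PZ.∂-+ Z.1# (yS Z.* rhs) ⟩
  PZ.∂ Z.1# Z.+ PZ.∂ (yS Z.* rhs)    ≈⟨ Z.+-cong D-1# (D-constˡ rhs ∂-yS) ⟩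
  Z.0# Z.+ yS Z.* PZ.∂ rhs           ≈⟨ Z.+-identityˡ (yS Z.* PZ.∂ rhs) ⟩
  yS Z.* PZ.∂ rhs                    ∎
  where open SetoidReasoning Z.setoid

growths-nonempty : ∀ x t → All Nonempty (growths x t)
growths-nonempty x t = All.tabulate (grow-nonempty ∘ ∈-growths⁻ t)

-- Weights ignore labels, so x is arbitrary. The clauses of `growths` and `weight` distinguish the
-- same cases, and each term of the Leibniz rule matches one sublist of growths.
∂-weight : ∀ x t → PZ.∂ (weight t) Z.≈ totalWeight (growths x t)
∂-weight x nil = D-1#
∂-weight x (node nil a nil) = begin
  PZ.∂ (PZ.∂ rhs)                                     ≈⟨ ∂∂rhs ⟩
  PZ.∂ rhs Z.* (yS Z.+ U)                             ≈⟨ Z.distribˡ (PZ.∂ rhs) yS U ⟩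
  PZ.∂ rhs Z.* yS Z.+ PZ.∂ rhs Z.* U                  ≈⟨ Z.+-cong (Z.*-comm (PZ.∂ rhs) yS) (Z.*-comm (PZ.∂ rhs) U) ⟩
  yS Z.* PZ.∂ rhs Z.+ U Z.* PZ.∂ rhs                  ≈⟨ Z.+-congˡ {yS Z.* PZ.∂ rhs} (Z.+-identityʳ (U Z.* PZ.∂ rhs)) ⟨
  yS Z.* PZ.∂ rhs Z.+ (U Z.* PZ.∂ rhs Z.+ Z.0#)       ∎
  where open SetoidReasoning Z.setoid
∂-weight x (node nil a r@(node _ _ _)) = begin
  PZ.∂ (U Z.* weight r)                               ≈⟨ PZ.∂-⊛ U (weight r) ⟩
  PZ.∂ U Z.* weight r Z.+ U Z.* PZ.∂ (weight r)       ≈⟨ Z.+-cong (Z.*-congʳ {weight r} ∂U) (Z.*-congˡ {U} (∂-weight x r)) ⟩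
  yS Z.* PZ.∂ rhs Z.* weight r Z.+ U Z.* totalWeight (growths x r)
    ≈⟨ Z.+-cong (Z.*-assoc yS (PZ.∂ rhs) (weight r)) (Z.sym (totalWeight-map (node nil a) U (λ { nonempty → Z.refl }) (growths-nonempty x r))) ⟩
  yS Z.* (PZ.∂ rhs Z.* weight r) Z.+ totalWeight (map (node nil a) (growths x r)) ∎
  where open SetoidReasoning Z.setoid
∂-weight x (node l@(node _ _ _) a nil) = begin
  PZ.∂ (yS Z.* weight l)                   ≈⟨ D-constˡ (weight l) ∂-yS ⟩
  yS Z.* PZ.∂ (weight l)                   ≈⟨ Z.*-congˡ {yS} (∂-weight x l) ⟩
  yS Z.* totalWeight (growths x l)         ≈⟨ totalWeight-map (λ l′ → node l′ a nil) yS (λ { nonempty → Z.refl }) (growths-nonempty x l) ⟨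
  totalWeight (map (λ l′ → node l′ a nil) (growths x l)) ∎
  where open SetoidReasoning Z.setoid
∂-weight x (node l@(node _ _ _) a r@(node _ _ _)) = begin
  PZ.∂ (yS Z.* (weight l Z.* weight r))    ≈⟨ D-constˡ (weight l Z.* weight r) ∂-yS ⟩
  yS Z.* PZ.∂ (weight l Z.* weight r)      ≈⟨ Z.*-congˡ {yS} (PZ.∂-⊛ (weight l) (weight r)) ⟩
  yS Z.* (PZ.∂ (weight l) Z.* weight r Z.+ weight l Z.* PZ.∂ (weight r))
    ≈⟨ Z.*-congˡ {yS} (Z.+-cong (Z.*-congʳ {weight r} (∂-weight x l)) (Z.*-congˡ {weight l} (∂-weight x r))) ⟩
  yS Z.* (totalWeight (growths x l) Z.* weight r Z.+ weight l Z.* totalWeight (growths x r))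
    ≈⟨ solve 5 (λ y p r l q → y :* (p :* r :+ l :* q) := y :* r :* p :+ y :* l :* q) Z.refl yS (totalWeight (growths x l)) (weight r) (weight l) (totalWeight (growths x r)) ⟩
  yS Z.* weight r Z.* totalWeight (growths x l) Z.+ yS Z.* weight l Z.* totalWeight (growths x r)
    ≈⟨ Z.+-cong (totalWeight-map (λ l′ → node l′ a r) (yS Z.* weight r) fˡ (growths-nonempty x l))
                (totalWeight-map (node l a) (yS Z.* weight l) fʳ (growths-nonempty x r)) ⟨
  totalWeight (map (λ l′ → node l′ a r) (growths x l)) Z.+ totalWeight (map (node l a) (growths x r))
    ≈⟨ totalWeight-++ (map (λ l′ → node l′ a r) (growths x l)) (map (node l a) (growths x r)) ⟨
  totalWeight (map (λ l′ → node l′ a r) (growths x l) ++ map (node l a) (growths x r)) ∎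
  where
  open SetoidReasoning Z.setoid
  fˡ : ∀ {t} → Nonempty t → weight (node t a r) Z.≈ yS Z.* weight r Z.* weight t
  fˡ {t} nonempty = solve 3 (λ y t r → y :* (t :* r) := y :* r :* t) Z.refl yS (weight t) (weight r)
  fʳ : ∀ {t} → Nonempty t → weight (node l a t) Z.≈ yS Z.* weight l Z.* weight t
  fʳ {t} nonempty = Z.sym (Z.*-assoc yS (weight l) (weight t))

∂-totalWeight : ∀ x ts → PZ.∂ (totalWeight ts) Z.≈ totalWeight (concatMap (growths x) ts)
∂-totalWeight x []       = λ n k → trans (×-pointwise (suc n) Y.0# k) (PY.×-0# (suc n))
∂-totalWeight x (t ∷ ts) = begin
  PZ.∂ (weight t Z.+ totalWeight ts)               ≈⟨ PZ.∂-+ (weight t) (totalWeight ts) ⟩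
  PZ.∂ (weight t) Z.+ PZ.∂ (totalWeight ts)        ≈⟨ Z.+-cong (∂-weight x t) (∂-totalWeight x ts) ⟩
  totalWeight (growths x t) Z.+ totalWeight (concatMap (growths x) ts) ≈⟨ totalWeight-++ (growths x t) (concatMap (growths x) ts) ⟨
  totalWeight (concatMap (growths x) (t ∷ ts))     ∎
  where open SetoidReasoning Z.setoid

-- The one-node shelf has weight `∂ rhs`, and each further derivative attaches the next label.
∂^-leaf : ∀ n → PZ.∂^ n (PZ.∂ rhs) Z.≈ totalWeight (shelves n)
∂^-leaf zero    = Z.sym (Z.+-identityʳ (PZ.∂ rhs))
∂^-leaf (suc n) = Z.trans (PZ.∂-cong (∂^-leaf n)) (∂-totalWeight (2 ℕ.+ n) (shelves n))

-- Values at z = 0 and comparison of coefficients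

y^_ : ℕ → ℕ → ℚ
y^ zero  = Y.1#
y^ suc j = PY.X PY.⊛ (y^ j)

y^-+ : ∀ i j → (y^ (i ℕ.+ j)) Y.≈ ((y^ i) Y.* (y^ j))
y^-+ zero    j = Y.sym (Y.*-identityˡ (y^ j))
y^-+ (suc i) j = Y.trans (Y.*-congˡ {PY.X} (y^-+ i j)) (Y.sym (Y.*-assoc PY.X (y^ i) (y^ j)))

y^-coeff-≡ : ∀ j → (y^ j) j ≡ 1ℚ
y^-coeff-≡ zero    = refl
y^-coeff-≡ (suc j) = trans (PY.X-⊛-suc (y^ j) Y.refl j) (y^-coeff-≡ j)

y^-coeff-≢ : ∀ j k → j ≢ k → (y^ j) k ≡ 0ℚ
y^-coeff-≢ zero    zero    j≢k = contradiction refl j≢k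
y^-coeff-≢ zero    (suc k) j≢k = refl
y^-coeff-≢ (suc j) zero    j≢k = PY.X-⊛-zero (y^ j) Y.refl
y^-coeff-≢ (suc j) (suc k) j≢k = trans (PY.X-⊛-suc (y^ j) Y.refl k) (y^-coeff-≢ j k (j≢k ∘ cong suc))

U-0 : U 0 Y.≈ Y.1#
U-0 = begin
  Y.1# Y.+ yS 0 Y.* rhs 0    ≈⟨ Y.+-congˡ {Y.1#} (Y.*-congˡ {yS 0} rhs-0) ⟩
  Y.1# Y.+ yS 0 Y.* Y.0#     ≈⟨ Y.+-congˡ {Y.1#} (Y.zeroʳ (yS 0)) ⟩
  Y.1# Y.+ Y.0#              ≈⟨ Y.+-identityʳ Y.1# ⟩
  Y.1#                       ∎
  where open SetoidReasoning Y.setoid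

-- The factors `∂ rhs` and `U` are 1 at z = 0, so only one y per left child survives.
weight-0 : ∀ t → weight t 0 Y.≈ (y^ leftChildren t)
weight-0 nil = Y.refl
weight-0 (node nil a nil) = ∂rhs-0
weight-0 (node nil a r@(node _ _ _)) = Y.trans (Y.*-cong U-0 (weight-0 r)) (Y.*-identityˡ (y^ leftChildren r))
weight-0 (node l@(node _ _ _) a nil) = Y.trans (Y.*-cong (yS≋X 0) (weight-0 l))
  (Y.reflexive (cong (λ j → y^ suc j) (sym (ℕ.+-identityʳ (leftChildren l)))))
weight-0 (node l@(node _ _ _) a r@(node _ _ _)) = Y.*-cong (yS≋X 0)
  (Y.trans (Y.*-cong (weight-0 l) (weight-0 r)) (Y.sym (y^-+ (leftChildren l) (leftChildren r))))

totalWeight-0 : ∀ k ts → totalWeight ts 0 k ≡ length (filter (λ t → leftChildren t ℕ.≟ k) ts) · 1ℚ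
totalWeight-0 k []       = refl
totalWeight-0 k (t ∷ ts) with leftChildren t ℕ.≟ k
... | yes lc = begin
  weight t 0 k + totalWeight ts 0 k    ≡⟨ cong₂ _+_ (trans (weight-0 t k) (trans (cong (λ j → (y^ j) k) lc) (y^-coeff-≡ k))) (totalWeight-0 k ts) ⟩
  length (t ∷ filter (λ t → leftChildren t ℕ.≟ k) ts) · 1ℚ
    ≡⟨ cong (λ us → length us · 1ℚ) (List.filter-accept (λ t → leftChildren t ℕ.≟ k) {x = t} {xs = ts} lc) ⟨
  length (filter (λ t → leftChildren t ℕ.≟ k) (t ∷ ts)) · 1ℚ ∎
  where open ≡-Reasoning
... | no ¬lc = begin
  weight t 0 k + totalWeight ts 0 k    ≡⟨ cong₂ _+_ (trans (weight-0 t k) (y^-coeff-≢ (leftChildren t) k ¬lc)) (totalWeight-0 k ts) ⟩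
  0ℚ + length (filter (λ t → leftChildren t ℕ.≟ k) ts) · 1ℚ
    ≡⟨ ℚ.+-identityˡ (length (filter (λ t → leftChildren t ℕ.≟ k) ts) · 1ℚ) ⟩
  length (filter (λ t → leftChildren t ℕ.≟ k) ts) · 1ℚ
    ≡⟨ cong (λ us → length us · 1ℚ) (List.filter-reject (λ t → leftChildren t ℕ.≟ k) {x = t} {xs = ts} ¬lc) ⟨
  length (filter (λ t → leftChildren t ℕ.≟ k) (t ∷ ts)) · 1ℚ ∎
  where open ≡-Reasoning

rhs-coeff : ∀ n k → (suc n !) · rhs (suc n) k ≡ length (shelvesWith n k) · 1ℚ
rhs-coeff n k = begin
  (suc n !) · rhs (suc n) k               ≡⟨ ×-pointwise (suc n !) (rhs (suc n)) k ⟨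
  ((suc n !) YMult.· rhs (suc n)) k       ≡⟨ PZ.taylor (suc n) rhs k ⟨
  PZ.∂^ (suc n) rhs 0 k                   ≡⟨ cong (λ f → f 0 k) (PZ.∂^-∂ n rhs) ⟨
  PZ.∂^ n (PZ.∂ rhs) 0 k                  ≡⟨ ∂^-leaf n 0 k ⟩
  totalWeight (shelves n) 0 k             ≡⟨ totalWeight-0 k (shelves n) ⟩
  length (shelvesWith n k) · 1ℚ           ∎
  where open ≡-Reasoning

theorem7 : ((k : ℕ) → rhs 0 k ≡ 0ℚ)
    × ((n k m : ℕ) → n ≥ 1 → (Fin m ↔ G n k)
    → rhs n k ≡ (+ m / (n !)) {{n !≢0}})
-- Both sides are compared after multiplication by the factorial, where they become the same count
-- of shelves.
theorem7 = rhs-0 , λ { (suc n) k m (s≤s _) iso → ×-cancelˡ (suc n !) {{suc n !≢0}} (begin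
  (suc n !) · rhs (suc n) k                          ≡⟨ rhs-coeff n k ⟩
  length (shelvesWith n k) · 1ℚ                      ≡⟨ cong (_· 1ℚ) (Fin↔G⇒≡ iso) ⟨
  m · 1ℚ                                             ≡⟨ ×-/ m (suc n !) {{suc n !≢0}} ⟨
  (suc n !) · ((+ m / (suc n !)) {{suc n !≢0}})      ∎) }
  where open ≡-Reasoning
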